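{- There are 85 connected cubic graphs on 12 vertices (up to isomorphism), exactly 17 of which are 3-balanced.
   Context: A graph is 3-balanced if it admits a vertex coloring $\ell:V\to\mathbb{Z}_3$ such that every vertex has, in its open neighborhood, the same number of vertices of each of the three colors. -}

module Defs where

open import Data.Nat using (ℕ; zero; suc; _+_)
open import Data.Fin using (Fin; zero; suc)
open import Data.Fin.Permutation using (Permutation′; _⟨$⟩ʳ_)
open import Data.Bool using (Bool; true; false; if_then_else_)
open import Data.Vec using (Vec; lookup)
open import Data.Product using (Σ; ∃; _×_; _,_)
open import Relation.Binary.PropositionalEquality using (_≡_; _≢_)
open import Relation.Nullary using (¬_)
open import Data.Sum using (_⊎_)

record Graph (n : ℕ) : Set where
  field
    adj   : Fin n → Fin n → Bool
    sym   : ∀ u v → adj u v ≡ adj v u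
    irrefl : ∀ v → adj v v ≡ false
open Graph public

count : ∀ {n} → (Fin n → Bool) → ℕ
count {zero}  p = 0
count {suc n} p = (if p zero then 1 else 0) + count (λ i → p (suc i))

degree : ∀ {n} → Graph n → Fin n → ℕ
degree G v = count (adj G v)

Cubic : ∀ {n} → Graph n → Set
Cubic G = ∀ v → degree G v ≡ 3

data Reachable {n} (G : Graph n) : Fin n → Fin n → Set where
  here : ∀ {u} → Reachable G u u
  step : ∀ {u v w} → adj G u v ≡ true → Reachable G v w → Reachable G u w

Connected : ∀ {n} → Graph n → Set
Connected G = ∀ u v → Reachable G u v

Isomorphic : ∀ {n} → Graph n → Graph n → Set
Isomorphic {n} G H =
  Σ (Permutation′ n) λ σ → ∀ u v → adj G u v ≡ adj H (σ ⟨$⟩ʳ u) (σ ⟨$⟩ʳ v)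

-- Z_3 is Fin 3. A colouring ℓ is balanced if every vertex has equally many
-- neighbours of each of the three colours in its open neighbourhood.
_≟3_ : Fin 3 → Fin 3 → Bool
zero ≟3 zero = true
suc zero ≟3 suc zero = true
suc (suc zero) ≟3 suc (suc zero) = true
_ ≟3 _ = false

colourCount : ∀ {n} → Graph n → (Fin n → Fin 3) → Fin n → Fin 3 → ℕ
colourCount G ℓ v c = count (λ u → if adj G v u then ℓ u ≟3 c else false)

ThreeBalanced : ∀ {n} → Graph n → Set
ThreeBalanced {n} G = Σ (Fin n → Fin 3) λ ℓ → ∀ v →
  (colourCount G ℓ v zero ≡ colourCount G ℓ v (suc zero)) ×
  (colourCount G ℓ v (suc zero) ≡ colourCount G ℓ v (suc (suc zero)))

ConnectedCubic : ∀ {n} → Graph n → Set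
ConnectedCubic G = Connected G × Cubic G

record Classification (k m : ℕ) : Set where
  field
    bal    : Vec (Graph 12) k
    unbal  : Vec (Graph 12) m
    bal-cc   : ∀ i → ConnectedCubic (lookup bal i)
    unbal-cc : ∀ i → ConnectedCubic (lookup unbal i)
    bal-3b   : ∀ i → ThreeBalanced (lookup bal i)
    unbal-¬3b : ∀ i → ¬ ThreeBalanced (lookup unbal i)
    bal-distinct   : ∀ i j → i ≢ j → ¬ Isomorphic (lookup bal i) (lookup bal j)
    unbal-distinct : ∀ i j → i ≢ j → ¬ Isomorphic (lookup unbal i) (lookup unbal j)
    cross-distinct : ∀ i j → ¬ Isomorphic (lookup bal i) (lookup unbal j)
    complete : ∀ (G : Graph 12) → ConnectedCubic G →
      (∃ λ i → Isomorphic G (lookup bal i)) ⊎ (∃ λ j → Isomorphic G (lookup unbal j))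

{-# OPTIONS --safe #-}
-- Completeness is an exhaustive search. Call a partial graph P settled if every connected cubic graph
-- containing P is in the list. A listed graph is settled, because a cubic graph has no proper cubic
-- spanning subgraph. P is settled as soon as it contains a settled graph, or its saturated vertices
-- form a proper union of components, or for some unsaturated vertex v every P + vw is settled.
-- A certificate with about 1400 steps derives from these rules that the edgeless graph is settled.
--
-- The listed graphs are told apart by walk counts. A balanced colouring of a cubic graph gives
-- different colours to vertices with a common neighbour, so its absence is shown by backtracking.
module Submission where

open import Defs renaming (sym to adj-sym)
open import Data.Bool using (Bool; true; false; if_then_else_; not; _∧_; _∨_)
open import Data.Bool.Properties using (∧-zeroʳ; ∨-comm) renaming (_≟_ to _≟ᵇ_)
open import Data.Empty using (⊥-elim)
open import Data.Fin as Fin using (Fin; zero; suc; fromℕ; splitAt; _↑ˡ_; _↑ʳ_)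
open import Data.Fin.Induction using (<-wellFounded)
open import Data.Fin.Permutation
  using (Permutation′; _⟨$⟩ʳ_; _⟨$⟩ˡ_; _∘ₚ_; flip; insert; transpose; inverseˡ; inverseʳ)
  renaming (id to idₚ)
open import Data.Fin.Properties
  using (_≟_; any?; all?; splitAt-↑ˡ; splitAt-↑ʳ; ↑ˡ-injective; ↑ʳ-injective)
open import Data.List as List using (List; []; _∷_; allFin)
open import Data.List.Membership.Propositional using (_∈_)
open import Data.List.Membership.Propositional.Properties using (∈-allFin)
import Data.List.Relation.Unary.All as ListAll
open import Data.List.Relation.Unary.Any using (here; there)
open import Data.Maybe using (Maybe; just; nothing; _>>=_; is-just)
open import Data.Nat using (ℕ; zero; suc; _+_; _*_; _/_; _%_; _≤_; _<_; z≤n; s≤s)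
open import Data.Nat.DivMod using (_mod_)
open import Data.Nat.Properties as ℕ using
  ( +-0-commutativeMonoid; +-suc; +-mono-≤; ≤-refl; ≤-reflexive; ≤-trans; <-irrefl; <⇒≱; <-≤-trans
  ; suc-injective; m≤n+m)
open import Data.Product using (∃; Σ-syntax; ∃-syntax; _×_; _,_; proj₁; proj₂)
open import Data.Sum using (_⊎_; inj₁; inj₂; [_,_]′)
open import Data.Unit using (tt)
open import Data.Vec as Vec using (Vec; []; _∷_; lookup; tabulate; replicate; zipWith; _[_]%=_; _[_]≔_)
open import Data.Vec.Membership.Propositional.Properties using (∈-lookup)
open import Data.Vec.Properties using
  ( lookup∘updateAt; lookup∘updateAt′; lookup∘update′; lookup∘tabulate; lookup-replicate
  ; lookup-zipWith; lookup-map; lookup-++ˡ; lookup-++ʳ)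
import Data.Vec.Relation.Unary.All as VecAll
open import Data.Vec.Relation.Unary.AllPairs using (allPairs?)
open import Data.Vec.Relation.Unary.Unique.Propositional using (Unique)
open import Data.Vec.Relation.Unary.Unique.Propositional.Properties using (lookup-injective)
open import Function using (_∘_)
open import Induction.WellFounded using (Acc; acc)
open import Relation.Binary.PropositionalEquality
  using (_≡_; _≢_; refl; sym; trans; cong; cong₂; subst; module ≡-Reasoning)
open import Relation.Nullary using (Dec; yes; no; does; ¬_; ¬?; _×-dec_; _⊎-dec_)
open import Relation.Nullary.Decidable using (toWitness; dec⇒maybe)

open import Algebra.Properties.CommutativeMonoid.Sum +-0-commutativeMonoid
  using (sum; sum-permute; sum-cong-≗)

-- Counting

-- No canonical form and no symmetry breaking has to be justified. A graph contains a pattern when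
-- some relabelling of the pattern is a spanning subgraph of it, so settledness does not depend on
-- the names of the vertices. A choice made without loss of generality is then an ordinary lookup:
-- the pattern at hand contains a copy of one settled before. The obstacle is size, since everything
-- is evaluated by the type checker. The certificate therefore supplies the permutation for each
-- lookup and the vertex for each branching, and the checker only tests inclusions of edge sets and
-- degrees. It is untrusted data: the checker returns a proof of settledness or nothing. For the
-- colourings, three equal colour counts that add up to the degree 3 are all 1; this is why no two
-- neighbours of one vertex share a colour.

count≡sum : ∀ {n} (p : Fin n → Bool) → count p ≡ sum (λ i → if p i then 1 else 0)
count≡sum {zero}  p = refl
count≡sum {suc n} p = cong ((if p zero then 1 else 0) +_) (count≡sum (p ∘ suc))

count-permute : ∀ {n} (π : Permutation′ n) (p : Fin n → Bool) → count p ≡ count (p ∘ (π ⟨$⟩ʳ_))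
count-permute π p = trans (count≡sum p) (trans (sum-permute _ π) (sym (count≡sum (p ∘ (π ⟨$⟩ʳ_)))))

count-mono : ∀ {n} {p q : Fin n → Bool} → (∀ i → p i ≡ true → q i ≡ true) → count p ≤ count q
count-mono {zero} p⊆q = z≤n
count-mono {suc n} {p} {q} p⊆q = +-mono-≤ head (count-mono (λ i → p⊆q (suc i)))
  where
  head : (if p zero then 1 else 0) ≤ (if q zero then 1 else 0)
  head with p zero in eq
  ... | false = z≤n
  ... | true rewrite p⊆q zero eq = ≤-refl

count-<⇒∃ : ∀ {n} (p q : Fin n → Bool) → count p < count q → ∃[ i ] q i ≡ true × p i ≡ false
count-<⇒∃ p q p<q with any? (λ i → (q i ≟ᵇ true) ×-dec (p i ≟ᵇ false))
... | yes found = found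
... | no none = ⊥-elim (<⇒≱ p<q (count-mono q⊆p))
  where
  q⊆p : ∀ i → q i ≡ true → p i ≡ true
  q⊆p i qi with p i in eq
  ... | true = refl
  ... | false = ⊥-elim (none (i , qi , eq))

-- A strict inclusion would make the second count larger. This is how a saturated vertex is shown to
-- have no neighbours in the host beyond those of the pattern.
count-⊆-≡ : ∀ {n} {p q : Fin n → Bool} → (∀ i → p i ≡ true → q i ≡ true) → count p ≡ count q →
            ∀ i → q i ≡ true → p i ≡ true
count-⊆-≡ {suc n} {p} {q} p⊆q eq i qi with p zero in pz | q zero in qz
... | true  | false with () ← trans (sym (p⊆q zero pz)) qz
... | false | true  = ⊥-elim (<-irrefl eq (s≤s (count-mono (λ i → p⊆q (suc i)))))
count-⊆-≡ p⊆q eq zero qi    | true | true = pz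
count-⊆-≡ p⊆q eq (suc i) qi | true | true = count-⊆-≡ (λ i → p⊆q (suc i)) (suc-injective eq) i qi
count-⊆-≡ p⊆q eq zero qi    | false | false with () ← trans (sym qi) qz
count-⊆-≡ p⊆q eq (suc i) qi | false | false = count-⊆-≡ (λ i → p⊆q (suc i)) eq i qi

count-≥1 : ∀ {n} (p : Fin n → Bool) i → p i ≡ true → 1 ≤ count p
count-≥1 p zero    pi rewrite pi = s≤s z≤n
count-≥1 p (suc i) pi = ≤-trans (count-≥1 (p ∘ suc) i pi) (m≤n+m _ _)

count-≥2 : ∀ {n} (p : Fin n → Bool) {i j} → i ≢ j → p i ≡ true → p j ≡ true → 2 ≤ count p
count-≥2 p {zero}  {zero}  i≢j pi pj = ⊥-elim (i≢j refl)
count-≥2 p {zero}  {suc j} i≢j pi pj rewrite pi = s≤s (count-≥1 (p ∘ suc) j pj)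
count-≥2 p {suc i} {zero}  i≢j pi pj rewrite pj = s≤s (count-≥1 (p ∘ suc) i pi)
count-≥2 p {suc i} {suc j} i≢j pi pj =
  ≤-trans (count-≥2 (p ∘ suc) (i≢j ∘ cong suc) pi pj) (m≤n+m _ _)

-- Embeddings of partial graphs into cubic graphs

-- `ρ` is a bijection on all vertices and non-edges may become edges: `H` is, up to relabelling, a
-- spanning subgraph of `G`, not an induced one.
_↪_ : ∀ {n} → Graph n → Graph n → Set
_↪_ {n} H G = Σ[ ρ ∈ Permutation′ n ] ∀ u v → adj H u v ≡ true → adj G (ρ ⟨$⟩ʳ u) (ρ ⟨$⟩ʳ v) ≡ true

↪-trans : ∀ {n} {F G H : Graph n} → F ↪ G → G ↪ H → F ↪ H
↪-trans (σ , σ-hom) (ρ , ρ-hom) = σ ∘ₚ ρ , λ u v uv → ρ-hom _ _ (σ-hom u v uv)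

module _ {n} {H G : Graph n} (cubic : Cubic G) (H↪G : H ↪ G) where
  private
    ρ = proj₁ H↪G
    hom = proj₂ H↪G

    pullback-degree : ∀ v → count (λ u → adj G (ρ ⟨$⟩ʳ v) (ρ ⟨$⟩ʳ u)) ≡ 3
    pullback-degree v = trans (sym (count-permute ρ _)) (cubic _)

  -- The image of `v` has only three neighbours in `G`, and the images of the three neighbours of
  -- `v` in `H` already fill these places.
  saturated⇒reflects : ∀ v → degree H v ≡ 3 → ∀ u → adj G (ρ ⟨$⟩ʳ v) (ρ ⟨$⟩ʳ u) ≡ true → adj H v u ≡ true
  saturated⇒reflects v deg = count-⊆-≡ (hom v) (trans deg (sym (pullback-degree v)))

  -- The host has three edges at the image of `v`, and `H` supplies fewer than three of them. The
  -- missing edge is the one on which the search branches.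
  unsaturated⇒missing : ∀ v → degree H v < 3 →
    ∃[ w ] adj G (ρ ⟨$⟩ʳ v) (ρ ⟨$⟩ʳ w) ≡ true × adj H v w ≡ false
  unsaturated⇒missing v deg = count-<⇒∃ _ _ (<-≤-trans deg (≤-reflexive (sym (pullback-degree v))))

  cubic↪⇒isomorphic : Cubic H → Isomorphic G H
  -- The isomorphism has to go from `G` to `H`, so the embedding is inverted; `u` and `v` are
  -- rewritten as images under `ρ`.
  cubic↪⇒isomorphic cubicH = flip ρ , λ u v →
    trans (cong₂ (adj G) (sym (inverseʳ ρ)) (sym (inverseʳ ρ))) (sym (same (ρ ⟨$⟩ˡ u) (ρ ⟨$⟩ˡ v)))
    where
    same : ∀ u v → adj H u v ≡ adj G (ρ ⟨$⟩ʳ u) (ρ ⟨$⟩ʳ v)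
    same u v with adj H u v in h | adj G (ρ ⟨$⟩ʳ u) (ρ ⟨$⟩ʳ v) in g
    ... | true  | true  = refl
    ... | false | false = refl
    ... | true  | false = trans (sym (hom u v h)) g
    ... | false | true  = trans (sym h) (saturated⇒reflects u (cubicH u) v g)

-- The matrix records each edge in one direction only.
record Pattern (n : ℕ) : Set where
  constructor mkPattern
  field
    edges    : List (Fin n × Fin n)
    matrix   : Vec (Vec Bool n) n
    recorded : ∀ u v → lookup (lookup matrix u) v ≡ true → (u , v) ∈ edges

  -- Symmetrising the matrix and clearing its diagonal gives a graph for every matrix, so no entry
  -- has to be validated when an edge is added.
  graph : Graph n
  graph .adj u v = (lookup (lookup matrix u) v ∨ lookup (lookup matrix v) u) ∧ not (does (u ≟ v))
  graph .adj-sym u v with u ≟ v | v ≟ u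
  ... | yes _   | yes _   = trans (∧-zeroʳ _) (sym (∧-zeroʳ _))
  ... | no  _   | no  _   = cong (_∧ true) (∨-comm (lookup (lookup matrix u) v) _)
  ... | yes u≡v | no  v≢u = ⊥-elim (v≢u (sym u≡v))
  ... | no  u≢v | yes v≡u = ⊥-elim (u≢v (sym v≡u))
  graph .irrefl v with v ≟ v
  ... | yes _   = ∧-zeroʳ _
  ... | no v≢v = ⊥-elim (v≢v refl)

  -- This turns a check that runs over the edge list into a statement about all adjacent pairs, with
  -- the pair listed in either orientation.
  adjacent⇒edge : ∀ u v → adj graph u v ≡ true → (u , v) ∈ edges ⊎ (v , u) ∈ edges
  adjacent⇒edge u v uv with lookup (lookup matrix u) v in eq | lookup (lookup matrix v) u in eq′
  ... | true  | _     = inj₁ (recorded u v eq)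
  ... | false | true  = inj₂ (recorded v u eq′)

open Pattern

edgeless : ∀ n → Pattern n
edgeless n .edges = []
edgeless n .matrix = replicate n (replicate n false)
edgeless n .recorded u v eq
  rewrite lookup-replicate u (replicate n false) | lookup-replicate v false with () ← eq

update-lookup : ∀ {n} (M : Vec (Vec Bool n) n) a b u v →
  lookup (lookup (M [ a ]%= (_[ b ]≔ true)) u) v ≡ true →
  (u , v) ≡ (a , b) ⊎ lookup (lookup M u) v ≡ true
update-lookup M a b u v eq with u ≟ a | v ≟ b
... | yes refl | yes refl = inj₁ refl
... | yes refl | no v≢b rewrite lookup∘updateAt u {_[ b ]≔ true} M | lookup∘update′ v≢b (lookup M u) true = inj₂ eq
... | no u≢a   | _ rewrite lookup∘updateAt′ u a {_[ b ]≔ true} u≢a M = inj₂ eq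

-- With a record expression instead of mkPattern, every projection would recompute the matrix.
_▸_ : ∀ {n} → Pattern n → Fin n × Fin n → Pattern n
P ▸ (a , b) = mkPattern ((a , b) ∷ edges P) (matrix P [ a ]%= (_[ b ]≔ true)) rec
  where
  rec : ∀ u v → lookup (lookup (matrix P [ a ]%= (_[ b ]≔ true)) u) v ≡ true → (u , v) ∈ (a , b) ∷ edges P
  rec u v eq with update-lookup (matrix P) a b u v eq
  ... | inj₁ uv≡ab = here uv≡ab
  ... | inj₂ old   = there (recorded P u v old)

▸-adjacent : ∀ {n} (P : Pattern n) a b u v → adj (graph (P ▸ (a , b))) u v ≡ true →
             (u , v) ≡ (a , b) ⊎ (v , u) ≡ (a , b) ⊎ adj (graph P) u v ≡ true
▸-adjacent P a b u v uv
  with lookup (lookup (matrix (P ▸ (a , b))) u) v in eq | lookup (lookup (matrix (P ▸ (a , b))) v) u in eq′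
... | true | _ with update-lookup (matrix P) a b u v eq
...   | inj₁ new = inj₁ new
...   | inj₂ old rewrite old = inj₂ (inj₂ uv)
▸-adjacent P a b u v uv | false | true with update-lookup (matrix P) a b v u eq′
...   | inj₁ new = inj₂ (inj₁ new)
...   | inj₂ old rewrite old with lookup (lookup (matrix P) u) v
...     | true  = inj₂ (inj₂ uv)
...     | false = inj₂ (inj₂ uv)

_covers_by_ : ∀ {n} (P Q : Pattern n) (σ : Permutation′ n) → Set
P covers Q by σ = ListAll.All (λ (a , b) → adj (graph P) (σ ⟨$⟩ʳ a) (σ ⟨$⟩ʳ b) ≡ true) (edges Q)

covers? : ∀ {n} (P Q : Pattern n) σ → Dec (P covers Q by σ)
covers? P Q σ = ListAll.all? (λ _ → _ ≟ᵇ true) (edges Q)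

covers⇒↪ : ∀ {n} (P Q : Pattern n) σ → P covers Q by σ → graph Q ↪ graph P
covers⇒↪ P Q σ cov = σ , hom
  where
  hom : ∀ u v → adj (graph Q) u v ≡ true → adj (graph P) (σ ⟨$⟩ʳ u) (σ ⟨$⟩ʳ v) ≡ true
  hom u v uv with adjacent⇒edge Q u v uv
  ... | inj₁ e = ListAll.lookup cov e
  ... | inj₂ e = trans (adj-sym (graph P) _ _) (ListAll.lookup cov e)

edgeless↪ : ∀ {n} (G : Graph n) → graph (edgeless n) ↪ G
edgeless↪ {n} G = idₚ , λ u v uv → [ (λ ()) , (λ ()) ]′ (adjacent⇒edge (edgeless n) u v uv)

-- The exhaustive search

module Search {n} (Listed : Graph (suc n) → Set) where

  Settled : Pattern (suc n) → Set
  Settled P = ∀ G → ConnectedCubic G → graph P ↪ G → Listed G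

  -- A host of `P` is also a host of every pattern that embeds in `P`. All use of symmetry in the
  -- search rests on this rule.
  cover-settled : ∀ P Q σ → P covers Q by σ → Settled Q → Settled P
  cover-settled P Q σ cov settled G cc P↪G =
    settled G cc (↪-trans {F = graph Q} {graph P} {G} (covers⇒↪ P Q σ cov) P↪G)

  -- The saturated vertices form a union of components that contains the first vertex but not the last.
  Closed : Pattern (suc n) → Set
  Closed P = degree (graph P) zero ≡ 3
           × degree (graph P) (fromℕ n) ≢ 3
           × ListAll.All (λ (a , b) → degree (graph P) a ≡ 3 × degree (graph P) b ≡ 3) (edges P)

  closed? : ∀ P → Dec (Closed P)
  closed? P = (degree (graph P) zero ℕ.≟ 3)
        ×-dec ¬? (degree (graph P) (fromℕ n) ℕ.≟ 3)
        ×-dec ListAll.all? (λ _ → (_ ℕ.≟ 3) ×-dec (_ ℕ.≟ 3)) (edges P)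

  -- Saturation spreads along every path of a host: the host edges at a saturated vertex all come
  -- from `P`, and edges of `P` end in saturated vertices. A path from the image of the first vertex
  -- to that of the last, pulled back by `ρ`, would make the last vertex saturated, so no connected
  -- host exists.
  closed-settled : ∀ P → Closed P → Settled P
  closed-settled P (deg₀ , degₙ≢3 , closed) G (connected , cubic) P↪G@(ρ , hom) =
    ⊥-elim (degₙ≢3 (subst (λ v → degree H v ≡ 3) (inverseˡ ρ)
      (spread (connected (ρ ⟨$⟩ʳ zero) (ρ ⟨$⟩ʳ fromℕ n)) (subst (λ v → degree H v ≡ 3) (sym (inverseˡ ρ)) deg₀))))
    where
    H = graph P

    closed-adj : ∀ u v → adj H u v ≡ true → degree H v ≡ 3
    closed-adj u v uv with adjacent⇒edge P u v uv
    ... | inj₁ e = proj₂ (ListAll.lookup closed e)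
    ... | inj₂ e = proj₁ (ListAll.lookup closed e)

    spread : ∀ {x y} → Reachable G x y → degree H (ρ ⟨$⟩ˡ x) ≡ 3 → degree H (ρ ⟨$⟩ˡ y) ≡ 3
    spread here deg = deg
    spread {x} (step {v = v} xv path) deg = spread path (closed-adj (ρ ⟨$⟩ˡ x) (ρ ⟨$⟩ˡ v)
      (saturated⇒reflects {H = H} {G} cubic P↪G (ρ ⟨$⟩ˡ x) deg (ρ ⟨$⟩ˡ v)
        (trans (cong₂ (adj G) (inverseʳ ρ) (inverseʳ ρ)) xv)))

  -- The three reasons why `w` cannot be the other end of a host edge at `v` that `P` lacks.
  Excluded : Pattern (suc n) → Fin (suc n) → Fin (suc n) → Set
  Excluded P v w = w ≡ v ⊎ adj (graph P) v w ≡ true ⊎ degree (graph P) w ≡ 3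

  excluded? : ∀ P v w → Dec (Excluded P v w)
  excluded? P v w = (w ≟ v) ⊎-dec (adj (graph P) v w ≟ᵇ true) ⊎-dec (degree (graph P) w ℕ.≟ 3)

  Child : Pattern (suc n) → Fin (suc n) → Fin (suc n) → Set
  Child P v w = Excluded P v w ⊎ Settled (P ▸ (v , w))

  -- Every cubic host has an edge at the image of `v` that does not come from `P`. Its other end is
  -- the image of some `w` that is not excluded, and the same `ρ` then embeds `P ▸ (v , w)` in the
  -- host.
  children-settled : ∀ P v → degree (graph P) v < 3 → (∀ w → Child P v w) → Settled P
  children-settled P v deg children G cc@(_ , cubic) P↪G@(ρ , hom)
    with w , ρvw , vw≡false ← unsaturated⇒missing {H = graph P} {G} cubic P↪G v deg
    with children w
  ... | inj₁ (inj₁ refl) with () ← trans (sym ρvw) (irrefl G _)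
  ... | inj₁ (inj₂ (inj₁ vw)) with () ← trans (sym vw) vw≡false
  -- Here `w` is saturated, so its host neighbours come from `P`, and the missing edge would already
  -- be in `P`.
  ... | inj₁ (inj₂ (inj₂ deg-w)) with () ← trans
          (sym (saturated⇒reflects {H = graph P} {G} cubic P↪G w deg-w v (trans (adj-sym G _ _) ρvw)))
          (trans (adj-sym (graph P) w v) vw≡false)
  ... | inj₂ settled = settled G cc (ρ , hom′)
    where
    hom′ : ∀ a b → adj (graph (P ▸ (v , w))) a b ≡ true → adj G (ρ ⟨$⟩ʳ a) (ρ ⟨$⟩ʳ b) ≡ true
    hom′ a b ab with ▸-adjacent P v w a b ab
    ... | inj₁ refl = ρvw
    ... | inj₂ (inj₁ refl) = trans (adj-sym G _ _) ρvw
    ... | inj₂ (inj₂ old) = hom a b old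

  -- Certificates and their checker

  Library : Set
  Library = List (∃ Settled)

  entry : ℕ → Library → Maybe (∃ Settled)
  entry _       []      = nothing
  entry zero    (x ∷ _) = just x
  entry (suc i) (_ ∷ Γ) = entry i Γ

  -- "found i c" embeds entry i of the library (latest first) by the permutation with Lehmer code c.
  -- "split v cs" lists certificates for the children P ▸ (v , w) in increasing order of w, without those
  -- that are excluded or arise from the last certified child by a transposition.
  data Certificate : Set where
    found  : ℕ → ℕ → Certificate
    closed : Certificate
    split  : ℕ → List Certificate → Certificate

  -- The digits in mixed radix m, m - 1, ..., 1, least significant first, give the images of 0, 1,
  -- ... among the values still free. Every number thus decodes to a permutation. The code 0 is the
  -- identity, and for twelve vertices 12!/2 = 239500800 interchanges the last two.
  lehmer : ∀ m → ℕ → Permutation′ m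
  lehmer zero    c = idₚ
  lehmer (suc m) c = insert zero (c mod suc m) (lehmer m (c / suc m))

  -- If interchanging `w′` and `w` preserves `P` and fixes `v`, the two children are isomorphic. In
  -- particular all vertices without edges count as one choice.
  swapped : ∀ P v w → Maybe (∃ λ w′ → Settled (P ▸ (v , w′))) → Maybe (Settled (P ▸ (v , w)))
  swapped P v w nothing = nothing
  swapped P v w (just (w′ , settled)) = do
    cov ← dec⇒maybe (covers? (P ▸ (v , w)) (P ▸ (v , w′)) (transpose w′ w))
    just (cover-settled (P ▸ (v , w)) (P ▸ (v , w′)) (transpose w′ w) cov settled)

  -- The library is threaded through the tree in depth-first order, and a node enters it after its
  -- descendants. A pattern settled in one branch can therefore be cited in every later branch.
  verify : Library → ∀ P → Certificate → Maybe (Settled P × Library)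
  verifyChildren : Library → ∀ P v → Maybe (∃ λ w → Settled (P ▸ (v , w))) →
                   (ws : List (Fin (suc n))) → List Certificate → Maybe (ListAll.All (Child P v) ws × Library)

  verify Γ P (found i c) = do
    Q , settled ← entry i Γ
    cov ← dec⇒maybe (covers? P Q (lehmer (suc n) c))
    -- `P` is not added: whatever contains `P` also contains the entry just used.
    just (cover-settled P Q (lehmer (suc n) c) cov settled , Γ)
  verify Γ P closed = do
    c ← dec⇒maybe (closed? P)
    just (closed-settled P c , (P , closed-settled P c) ∷ Γ)
  verify Γ P (split v cs) = do
    deg ← dec⇒maybe (degree (graph P) (v mod suc n) ℕ.<? 3)
    children , Γ′ ← verifyChildren Γ P (v mod suc n) nothing (allFin (suc n)) cs
    let settled = children-settled P (v mod suc n) deg (λ w → ListAll.lookup children (∈-allFin w))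
    just (settled , (P , settled) ∷ Γ′)

  verifyChildren Γ P v last [] _ = just (ListAll.[] , Γ)
  verifyChildren Γ P v last (w ∷ ws) cs with dec⇒maybe (excluded? P v w)
  ... | just ex = do
    rest , Γ′ ← verifyChildren Γ P v last ws cs
    just (inj₁ ex ListAll.∷ rest , Γ′)
  ... | nothing with swapped P v w last
  ...   | just settled = do
    -- The reference stays the last child with its own certificate, so a run of interchangeable
    -- vertices is compared with one representative.
    rest , Γ′ ← verifyChildren Γ P v last ws cs
    just (inj₂ settled ListAll.∷ rest , Γ′)
  verifyChildren Γ P v last (w ∷ ws) [] | nothing | nothing = nothing
  verifyChildren Γ P v last (w ∷ ws) (c ∷ cs) | nothing | nothing = do
    settled , Γ′ ← verify Γ (P ▸ (v , w)) c
    rest , Γ″ ← verifyChildren Γ′ P v (just (w , settled)) ws cs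
    just (inj₂ settled ListAll.∷ rest , Γ″)

-- An isomorphism invariant

_⊕_ : ∀ {n} → Vec ℕ n → Vec ℕ n → Vec ℕ n
_⊕_ = zipWith _+_

neighbourSum : ∀ {m n} → (Fin m → Bool) → (Fin m → Vec ℕ n) → Vec ℕ n
neighbourSum {zero}  p f = replicate _ 0
neighbourSum {suc m} p f =
  if p zero then f zero ⊕ neighbourSum (p ∘ suc) (f ∘ suc) else neighbourSum (p ∘ suc) (f ∘ suc)

lookup-neighbourSum : ∀ {m n} (p : Fin m → Bool) (f : Fin m → Vec ℕ n) i →
  lookup (neighbourSum p f) i ≡ sum (λ u → if p u then lookup (f u) i else 0)
lookup-neighbourSum {zero}  p f i = lookup-replicate i 0
lookup-neighbourSum {suc m} p f i with p zero
... | true  = trans (lookup-zipWith _+_ i (f zero) _)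
                    (cong (lookup (f zero) i +_) (lookup-neighbourSum (p ∘ suc) (f ∘ suc) i))
... | false = lookup-neighbourSum (p ∘ suc) (f ∘ suc) i

-- Multiplication by I + A from the left, one row at a time.
lazyStep : ∀ {n} → Graph n → Vec (Vec ℕ n) n → Vec (Vec ℕ n) n
lazyStep G W = tabulate (λ u → lookup W u ⊕ neighbourSum (adj G u) (lookup W))

-- Entry (u , v) counts the walks of length k from u to v that may rest: the matrix is (I + A)ᵏ.
lazyWalks : ∀ {n} → Graph n → ℕ → Vec (Vec ℕ n) n
lazyWalks G zero    = tabulate (λ u → tabulate (λ v → if does (u ≟ v) then 1 else 0))
lazyWalks G (suc k) = lazyStep G (lazyWalks G k)

walkCount : ∀ {n} → Graph n → ℕ → Fin n → Fin n → ℕ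
walkCount G k u v = lookup (lookup (lazyWalks G k) u) v

walkCount-zero : ∀ {n} (G : Graph n) u v → walkCount G 0 u v ≡ (if does (u ≟ v) then 1 else 0)
walkCount-zero G u v = trans (cong (λ r → lookup r v) (lookup∘tabulate _ u)) (lookup∘tabulate _ v)

walkCount-suc : ∀ {n} (G : Graph n) k u v →
  walkCount G (suc k) u v ≡ walkCount G k u v + sum (λ w → if adj G u w then walkCount G k w v else 0)
walkCount-suc G k u v =
  trans (cong (λ r → lookup r v) (lookup∘tabulate _ u))
  (trans (lookup-zipWith _+_ v (lookup (lazyWalks G k) u) _)
    (cong (walkCount G k u v +_) (lookup-neighbourSum (adj G u) (lookup (lazyWalks G k)) v)))

-- Induction on the length by the first step of the walk, which rests at `u` or moves to a
-- neighbour. The isomorphism carries the neighbours of `u` onto those of its image, so the sum over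
-- them is merely reindexed.
walkCount-iso : ∀ {n} {G H : Graph n} ((σ , _) : Isomorphic G H) k u v →
  walkCount G k u v ≡ walkCount H k (σ ⟨$⟩ʳ u) (σ ⟨$⟩ʳ v)
walkCount-iso {G = G} {H} (σ , same) zero u v =
  trans (walkCount-zero G u v) (trans (cong (λ b → if b then 1 else 0) agree) (sym (walkCount-zero H _ _)))
  where
  agree : does (u ≟ v) ≡ does (σ ⟨$⟩ʳ u ≟ σ ⟨$⟩ʳ v)
  agree with u ≟ v | σ ⟨$⟩ʳ u ≟ σ ⟨$⟩ʳ v
  ... | yes _    | yes _ = refl
  ... | no  _    | no _  = refl
  ... | yes refl | no ≢  = ⊥-elim (≢ refl)
  ... | no u≢v   | yes ≡ = ⊥-elim (u≢v (trans (sym (inverseˡ σ)) (trans (cong (σ ⟨$⟩ˡ_) ≡) (inverseˡ σ))))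
walkCount-iso {G = G} {H} (σ , same) (suc k) u v = begin
  walkCount G (suc k) u v
    ≡⟨ walkCount-suc G k u v ⟩
  walkCount G k u v + sum (λ w → if adj G u w then walkCount G k w v else 0)
    ≡⟨ cong₂ _+_ (ih u) (sum-cong-≗ λ w → cong₂ (λ b x → if b then x else 0) (same u w) (ih w)) ⟩
  walkCount H k (σ ⟨$⟩ʳ u) (σ ⟨$⟩ʳ v) + sum (λ w → summand (σ ⟨$⟩ʳ w))
    ≡⟨ cong (walkCount H k (σ ⟨$⟩ʳ u) (σ ⟨$⟩ʳ v) +_) (sum-permute summand σ) ⟨
  walkCount H k (σ ⟨$⟩ʳ u) (σ ⟨$⟩ʳ v) + sum summand
    ≡⟨ walkCount-suc H k _ _ ⟨
  walkCount H (suc k) (σ ⟨$⟩ʳ u) (σ ⟨$⟩ʳ v) ∎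
  where
  open ≡-Reasoning
  ih = λ w → walkCount-iso {G = G} {H} (σ , same) k w v
  summand = λ w → if adj H (σ ⟨$⟩ʳ u) w then walkCount H k w (σ ⟨$⟩ʳ v) else 0

square : ℕ → ℕ
square m = m * m

-- Length 3 is enough to separate the 85 graphs.
walkInvariant : ∀ {n} → Graph n → ℕ
walkInvariant G = profile (lazyWalks G 3)
  where
  profile : Vec (Vec ℕ _) _ → ℕ
  -- The walk matrix is symmetric, so the inner sum is the diagonal entry at `u` of (I + A)⁶, the
  -- number of closed lazy walks of length 6. Without the inner square it would be 4³ = 64 at every
  -- vertex of a cubic graph; without the outer square the total would be the trace, which depends
  -- on the spectrum only.
  profile W = sum (λ u → square (sum (λ v → square (lookup (lookup W u) v))))

walkInvariant-iso : ∀ {n} (G H : Graph n) → Isomorphic G H → walkInvariant G ≡ walkInvariant H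
walkInvariant-iso G H iso@(σ , _) = begin
  sum (λ u → square (sum (λ v → square (walkCount G 3 u v))))
    ≡⟨ sum-cong-≗ (λ u → cong square (sum-cong-≗ λ v → cong square (walkCount-iso {G = G} {H} iso 3 u v))) ⟩
  sum (λ u → square (sum (λ v → square (walkCount H 3 (σ ⟨$⟩ʳ u) (σ ⟨$⟩ʳ v)))))
    ≡⟨ sum-cong-≗ (λ u → cong square (sum-permute (λ v → square (walkCount H 3 (σ ⟨$⟩ʳ u) v)) σ)) ⟨
  sum (λ u → square (sum (λ v → square (walkCount H 3 (σ ⟨$⟩ʳ u) v))))
    ≡⟨ sum-permute (λ u → square (sum (λ v → square (walkCount H 3 u v)))) σ ⟨
  sum (λ u → square (sum (λ v → square (walkCount H 3 u v)))) ∎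
  where open ≡-Reasoning

-- Pairwise non-isomorphism of two lists

module _ {k m n} (Gs : Vec (Graph n) k) (Hs : Vec (Graph n) m)
         (unique : Unique (Vec.map walkInvariant Gs Vec.++ Vec.map walkInvariant Hs)) where
  private
    invariants = Vec.map walkInvariant Gs Vec.++ Vec.map walkInvariant Hs

    left-invariant : ∀ i → lookup invariants (i ↑ˡ m) ≡ walkInvariant (lookup Gs i)
    left-invariant i = trans (lookup-++ˡ (Vec.map walkInvariant Gs) _ i) (lookup-map i walkInvariant Gs)

    right-invariant : ∀ j → lookup invariants (k ↑ʳ j) ≡ walkInvariant (lookup Hs j)
    right-invariant j = trans (lookup-++ʳ (Vec.map walkInvariant Gs) _ j) (lookup-map j walkInvariant Hs)

    -- Isomorphic graphs have equal invariants, and the joined list has no repetition. Joining the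
    -- lists lets one uniqueness check yield all three distinctness statements.
    same-index : ∀ a b (G H : Graph n) → lookup invariants a ≡ walkInvariant G → lookup invariants b ≡ walkInvariant H →
                 Isomorphic G H → a ≡ b
    same-index a b G H a≡ b≡ iso =
      lookup-injective unique a b (trans a≡ (trans (walkInvariant-iso G H iso) (sym b≡)))

  left-distinct : ∀ i j → i ≢ j → ¬ Isomorphic (lookup Gs i) (lookup Gs j)
  left-distinct i j i≢j iso = i≢j (↑ˡ-injective m i j
    (same-index _ _ (lookup Gs i) (lookup Gs j) (left-invariant i) (left-invariant j) iso))

  right-distinct : ∀ i j → i ≢ j → ¬ Isomorphic (lookup Hs i) (lookup Hs j)
  right-distinct i j i≢j iso = i≢j (↑ʳ-injective k i j
    (same-index _ _ (lookup Hs i) (lookup Hs j) (right-invariant i) (right-invariant j) iso))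

  cross-distinct : ∀ i j → ¬ Isomorphic (lookup Gs i) (lookup Hs j)
  -- One index would lie in both blocks of the joined list, and `splitAt` tells the blocks apart.
  cross-distinct i j iso with () ← trans (sym (splitAt-↑ˡ k i m)) (trans
    (cong (splitAt k)
      (same-index _ _ (lookup Gs i) (lookup Hs j) (left-invariant i) (right-invariant j) iso))
    (splitAt-↑ʳ k m j))

-- Connectedness

module _ {n} (G : Graph n) where

  reachable-trans : ∀ {u v w} → Reachable G u v → Reachable G v w → Reachable G u w
  reachable-trans here          vw = vw
  reachable-trans (step e path) vw = step e (reachable-trans path vw)

  reachable-sym : ∀ {u v} → Reachable G u v → Reachable G v u
  reachable-sym here = here
  reachable-sym (step e path) = reachable-trans (reachable-sym path) (step (trans (adj-sym G _ _) e) here)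

-- A witness of connectedness that is checked vertex by vertex: the chosen smaller neighbours form a
-- spanning tree rooted at `zero`.
Descending : ∀ {n} → Graph (suc n) → Set
Descending G = ∀ v → v ≡ zero ⊎ ∃[ u ] u Fin.< v × adj G v u ≡ true

descending? : ∀ {n} (G : Graph (suc n)) → Dec (Descending G)
descending? G = all? (λ v → (v ≟ zero) ⊎-dec any? (λ u → (u Fin.<? v) ×-dec (adj G v u ≟ᵇ true)))

descending⇒connected : ∀ {n} (G : Graph (suc n)) → Descending G → Connected G
descending⇒connected G descend u v =
  reachable-trans G (to-zero u (<-wellFounded u)) (reachable-sym G (to-zero v (<-wellFounded v)))
  where
  to-zero : ∀ v → Acc Fin._<_ v → Reachable G v zero
  to-zero v (acc rs) with descend v
  ... | inj₁ refl = here
  ... | inj₂ (u , u<v , vu) = step vu (to-zero u (rs u<v))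

-- Balanced colourings

≟3-refl : ∀ c → c ≟3 c ≡ true
≟3-refl zero = refl
≟3-refl (suc zero) = refl
≟3-refl (suc (suc zero)) = refl

-- Each selected vertex has exactly one of the three colours. Applied to a neighbourhood, this ties
-- the colour counts to the degree.
count-colours : ∀ {n} (p : Fin n → Bool) (ℓ : Fin n → Fin 3) →
  let class = λ c → count (λ u → if p u then ℓ u ≟3 c else false) in
  class zero + (class (suc zero) + class (suc (suc zero))) ≡ count p
count-colours {zero}  p ℓ = refl
count-colours {suc n} p ℓ with p zero | ℓ zero | count-colours (p ∘ suc) (ℓ ∘ suc)
... | false | _              | ih = ih
... | true  | zero           | ih = cong suc ih
... | true  | suc zero       | ih = trans (+-suc _ _) (cong suc ih)
... | true  | suc (suc zero) | ih =
  trans (cong (rest zero +_) (+-suc (rest (suc zero)) (rest (suc (suc zero)))))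
    (trans (+-suc (rest zero) _) (cong suc ih))
  where rest = λ c → count (λ u → if p (suc u) then ℓ (suc u) ≟3 c else false)

-- These pairs are the nonzero off-diagonal entries of A², the square of the adjacency matrix.
ShareNeighbour : ∀ {n} → Graph n → Fin n → Fin n → Set
ShareNeighbour G u w = u ≢ w × ∃[ v ] adj G v u ≡ true × adj G v w ≡ true

shareNeighbour? : ∀ {n} (G : Graph n) u w → Dec (ShareNeighbour G u w)
shareNeighbour? G u w = ¬? (u ≟ w) ×-dec any? (λ v → (adj G v u ≟ᵇ true) ×-dec (adj G v w ≟ᵇ true))

-- If `u` and `w` had the same colour, that colour would occur at least twice around their common
-- neighbour `v`, whereas balance and degree 3 leave one occurrence for each colour.
balanced-proper : ∀ {n} (G : Graph n) → Cubic G → ((ℓ , _) : ThreeBalanced G) →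
                  ∀ u w → ShareNeighbour G u w → ℓ u ≢ ℓ w
balanced-proper G cubic (ℓ , balanced) u w (u≢w , v , vu , vw) ℓu≡ℓw =
  too-many (trans (count-colours (adj G v) ℓ) (cubic v)) (proj₁ (balanced v)) (proj₂ (balanced v)) (ℓ u) twice
  where
  class = colourCount G ℓ v
  twice : 2 ≤ class (ℓ u)
  twice = count-≥2 _ u≢w
    (trans (cong (λ b → if b then ℓ u ≟3 ℓ u else false) vu) (≟3-refl (ℓ u)))
    (trans (cong (λ b → if b then ℓ w ≟3 ℓ u else false) vw)
      (trans (cong (_≟3 ℓ u) (sym ℓu≡ℓw)) (≟3-refl (ℓ u))))

  two-fails : ∀ {a b c} → a + (b + c) ≡ 3 → a ≡ b → b ≡ c → ¬ 2 ≤ a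
  two-fails {suc zero} eq refl refl (s≤s ())
  -- Three equal counts of at least 2 add up to at least 6; the contradiction uses only that this
  -- exceeds 3.
  two-fails {suc (suc a)} eq refl refl le =
    <-irrefl (sym eq) (≤-trans (s≤s (s≤s (s≤s (s≤s z≤n)))) (+-mono-≤ le (+-mono-≤ le le)))

  too-many : class zero + (class (suc zero) + class (suc (suc zero))) ≡ 3 →
             class zero ≡ class (suc zero) → class (suc zero) ≡ class (suc (suc zero)) →
             ∀ c → ¬ 2 ≤ class c
  too-many eq z o zero             le = two-fails eq z o le
  too-many eq z o (suc zero)       le = two-fails eq z o (subst (2 ≤_) (sym z) le)
  too-many eq z o (suc (suc zero)) le = two-fails eq z o (subst (2 ≤_) (sym (trans z o)) le)

-- Refuting proper 3-colourings by backtracking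

module _ {n} (conflicts : Vec (Vec Bool n) n) where

  clash : List (Fin n × Fin 3) → Fin n → Fin 3 → Bool
  clash []             w c = false
  clash ((u , d) ∷ as) w c = (does (c ≟ d) ∧ lookup (lookup conflicts u) w) ∨ clash as w c

  -- The value `true` certifies that the partial colouring `as` has no proper extension to the
  -- remaining vertices. With no vertex left the colouring has survived, hence `false`.
  uncolourable : List (Fin n × Fin 3) → List (Fin n) → Bool
  blocked : List (Fin n × Fin 3) → Fin n → List (Fin n) → Fin 3 → Bool
  uncolourable as []       = false
  uncolourable as (w ∷ ws) = blocked as w ws zero ∧ blocked as w ws (suc zero) ∧ blocked as w ws (suc (suc zero))
  blocked as w ws c = clash as w c ∨ uncolourable ((w , c) ∷ as) ws

  Proper : (Fin n → Fin 3) → Set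
  Proper ℓ = ∀ u w → lookup (lookup conflicts u) w ≡ true → ℓ u ≢ ℓ w

  module _ {ℓ} (proper : Proper ℓ) where

    clash-sound : ∀ as → ListAll.All (λ (u , d) → ℓ u ≡ d) as → ∀ w → clash as w (ℓ w) ≢ true
    clash-sound ((u , d) ∷ as) (ℓu≡d ListAll.∷ agree) w eq
      with ℓ w ≟ d | lookup (lookup conflicts u) w in uw
    ... | yes ℓw≡d | true  = proper u w uw (trans ℓu≡d (sym ℓw≡d))
    ... | yes _    | false = clash-sound as agree w eq
    ... | no _     | _     = clash-sound as agree w eq

    -- Follow the branch that `ℓ` itself chooses. The assignment keeps agreeing with `ℓ`, so a
    -- proper `ℓ` never runs into a clash, and at the end of the list the value is `false`.
    uncolourable-sound : ∀ as → ListAll.All (λ (u , d) → ℓ u ≡ d) as → ∀ ws → uncolourable as ws ≢ true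
    uncolourable-sound as agree (w ∷ ws) eq = split-∨ (conjunct (ℓ w) eq)
      where
      conjunct : ∀ c → uncolourable as (w ∷ ws) ≡ true → blocked as w ws c ≡ true
      conjunct c eq with blocked as w ws zero in b₀ | blocked as w ws (suc zero) in b₁ | blocked as w ws (suc (suc zero)) in b₂
      conjunct zero             eq | true | true | true = b₀
      conjunct (suc zero)       eq | true | true | true = b₁
      conjunct (suc (suc zero)) eq | true | true | true = b₂

      split-∨ : blocked as w ws (ℓ w) ≢ true
      split-∨ eq with clash as w (ℓ w) in hit
      ... | true  = clash-sound as agree w hit
      ... | false = uncolourable-sound ((w , ℓ w) ∷ as) (refl ListAll.∷ agree) ws eq

conflictMatrix : ∀ {n} → Graph n → Vec (Vec Bool n) n
conflictMatrix G = tabulate (λ u → tabulate (λ w → does (shareNeighbour? G u w)))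

NoColouring : ∀ {n} → Graph n → Set
NoColouring G = uncolourable (conflictMatrix G) [] (allFin _) ≡ true

noColouring? : ∀ {n} (G : Graph n) → Dec (NoColouring G)
noColouring? G = uncolourable (conflictMatrix G) [] (allFin _) ≟ᵇ true

noColouring⇒unbalanced : ∀ {n} (G : Graph n) → Cubic G → NoColouring G → ¬ ThreeBalanced G
noColouring⇒unbalanced G cubic none balanced@(ℓ , _) =
  uncolourable-sound (conflictMatrix G) proper [] ListAll.[] (allFin _) none
  where
  proper : Proper (conflictMatrix G) ℓ
  proper u w eq = balanced-proper G cubic balanced u w
    (does-true (shareNeighbour? G u w) shares)
    where
    does-true : ∀ {A : Set} (a? : Dec A) → does a? ≡ true → A
    does-true (yes a) _ = a

    shares : does (shareNeighbour? G u w) ≡ true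
    shares = trans (sym (trans (cong (λ r → lookup r w) (lookup∘tabulate _ u)) (lookup∘tabulate _ w))) eq

-- The classification

-- One byte per edge, its two halves being the end vertices. The lowest byte is the edge added last,
-- so a code that ends in 030201 has the edges from 0 to 1, 2 and 3 at the head of its list.
patternOf : ∀ {n} → ℕ → ℕ → Pattern (suc n)
patternOf zero    c = edgeless _
patternOf (suc k) c = patternOf k (c / 256) ▸ ((c / 16 % 16) mod suc _ , (c % 16) mod suc _)

-- The 18 edges of a graph, two hexadecimal digits per edge.
cubicPattern : ℕ → Pattern 12
cubicPattern = patternOf 18

balancedCodes : Vec ℕ 17
balancedCodes =
    0xab9b9a8b7a78696857463534251412030201
  ∷ 0x9b9a8b8a7b7a696857463534251412030201
  ∷ 0xab9b9a8b7a78695758463634251412030201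
  ∷ 0x9b9a8b8a7b7a695758463634251412030201
  ∷ 0xab9b8a897b676a5958473634251412030201
  ∷ 0x9b9a8b8a7b676a5958473634251412030201
  ∷ 0xab9b9a8b7a69575846483736251412030201
  ∷ 0xab9b8a897b6a575946483736251412030201
  ∷ 0x9a8b8a797b6b5a5946483736251412030201
  ∷ 0xab9b897a67685a5b49483736251412030201
  ∷ 0x9b9a8b8a7b7a696857363425241514030201
  ∷ 0x9b9a8b8a7a7b695846373625241514030201
  ∷ 0xab9b8a897b676a5948373526241514030201
  ∷ 0xab9b8b7a796a685948373526241514030201
  ∷ 0xab9a8b797b6a685948373526241514030201
  ∷ 0x9b9a8b7a7b6a685948373526241514030201
  ∷ 0xab9b8a897b6a565947373826241514030201
  ∷ []

unbalancedCodes : Vec ℕ 68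
unbalancedCodes =
    0xab9b9a8b8a79676857564534241312030201
  ∷ 0xab9b9a8b7a78696857564534241312030201
  ∷ 0xab9b8a897b7a696857564534241312030201
  ∷ 0x9b9a8b8a7b7a696857564534241312030201
  ∷ 0xab9b9a8b8a79676857464535241312030201
  ∷ 0xab9b9a8b7a78696857464535241312030201
  ∷ 0xab9b8a897b7a696857464535241312030201
  ∷ 0x9b9a8b8a7b7a696857464535241312030201
  ∷ 0xab9b9a8b8a79685756474635241312030201
  ∷ 0xab9b9a8b8a79675658474635241312030201
  ∷ 0xab9b9a8b7a78695658474635241312030201
  ∷ 0xab9b8b8a7a79695658474635241312030201
  ∷ 0x9b9a8b8a7b7a695658474635241312030201
  ∷ 0xab9b9a8b7a67685958474635241312030201
  ∷ 0xab9b8a7b7a69685958474635241312030201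
  ∷ 0xab9b8b897a676a5958474635241312030201
  ∷ 0xab9b8a897b676a5958474635241312030201
  ∷ 0x9b9a8b8a7b676a5958474635241312030201
  ∷ 0xab9b8b7a796a685958474635241312030201
  ∷ 0xab9b8a7b796a685958474635241312030201
  ∷ 0xab9a8b7b796a685958474635241312030201
  ∷ 0x9b9a8b7b7a6a685958474635241312030201
  ∷ 0xab9b8a897b7a696857463534251412030201
  ∷ 0xab9b9a8b7a78695658473634251412030201
  ∷ 0xab9b8b8a7a79695658473634251412030201
  ∷ 0xab9b8a897b7a695658473634251412030201
  ∷ 0x9b9a8b8a7b7a695658473634251412030201
  ∷ 0xab9b8a7b7a69685958473634251412030201
  ∷ 0xab9b8b7a796a685958473634251412030201
  ∷ 0xab9b9a7b786a685958473634251412030201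
  ∷ 0xab9b8a7b796a685958473634251412030201
  ∷ 0xab9a8b7b796a685958473634251412030201
  ∷ 0xab9b897b7a6a685958473634251412030201
  ∷ 0x9b9a8b7b7a6a685958473634251412030201
  ∷ 0x9b8a897b7a6a6b5958473634251412030201
  ∷ 0x9b9a8b8a7b6a595847463736251412030201
  ∷ 0x9b9a8b8a7a7b565946483736251412030201
  ∷ 0xab9b8b8a7a69575946483736251412030201
  ∷ 0xab9b8b897a6a575946483736251412030201
  ∷ 0xab9a8b897b6a575946483736251412030201
  ∷ 0x9b9a8b8a7b6a575946483736251412030201
  ∷ 0xab9b8a897b675a5946483736251412030201
  ∷ 0xab9b8b7a78695a5946483736251412030201
  ∷ 0xab9a8b7b78695a5946483736251412030201
  ∷ 0xab8b8a797b695a5946483736251412030201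
  ∷ 0x9b8b8a7a7b695a5946483736251412030201
  ∷ 0xab9b8a79786b5a5946483736251412030201
  ∷ 0xab9a8b79786b5a5946483736251412030201
  ∷ 0xab8b897a796b5a5946483736251412030201
  ∷ 0x9b9a8b7a67685a5b49483736251412030201
  ∷ 0x9b8a7a7b69685a5b49483736251412030201
  ∷ 0x9b8a797b6a685a5b49483736251412030201
  ∷ 0x9a8b797b6a685a5b49483736251412030201
  ∷ 0xab9b8b7a796a685948373625241514030201
  ∷ 0xab9a8b797b6a685948373625241514030201
  ∷ 0xab9a8b897b676a5948373526241514030201
  ∷ 0x9b9a8b8a7b676a5948373526241514030201
  ∷ 0xab9b8b7a786a695948373526241514030201
  ∷ 0x9b8b8a7a7b6a695948373526241514030201
  ∷ 0xab9b8a7b6a69595847373826241514030201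
  ∷ 0xab898b7b6a69595a47373826241514030201
  ∷ 0xab9b8b796a68575a49373826241514030201
  ∷ 0x9b9a8b7b6a68575a49373826241514030201
  ∷ 0x9b9a8a7b6b68575a49373826241514030201
  ∷ 0x9b8a897b6b6a575a49373826241514030201
  ∷ 0x898b7a796b6a5b5a49373826241514030201
  ∷ 0xab9a8b7b6a57594648393827261514030201
  ∷ 0xab9b8a796b575a4648393827261514030201
  ∷ []

balancedGraphs : Vec (Graph 12) 17
balancedGraphs = Vec.map (graph ∘ cubicPattern) balancedCodes

unbalancedGraphs : Vec (Graph 12) 68
unbalancedGraphs = Vec.map (graph ∘ cubicPattern) unbalancedCodes

cubic? : ∀ {n} (G : Graph n) → Dec (Cubic G)
cubic? G = all? (λ v → degree G v ℕ.≟ 3)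

All-lookup : ∀ {A : Set} {P : A → Set} {n} {xs : Vec A n} → VecAll.All P xs → ∀ i → P (lookup xs i)
All-lookup {xs = xs} ps i = VecAll.lookup ps (∈-lookup i xs)

all-balanced-cubic : VecAll.All Cubic balancedGraphs
all-balanced-cubic = toWitness {a? = VecAll.all? cubic? balancedGraphs} tt

all-unbalanced-cubic : VecAll.All Cubic unbalancedGraphs
all-unbalanced-cubic = toWitness {a? = VecAll.all? cubic? unbalancedGraphs} tt

balanced-cubic : ∀ i → Cubic (lookup balancedGraphs i)
balanced-cubic = All-lookup {P = Cubic} all-balanced-cubic

unbalanced-cubic : ∀ i → Cubic (lookup unbalancedGraphs i)
unbalanced-cubic = All-lookup {P = Cubic} all-unbalanced-cubic

-- The vertices of the 85 graphs are numbered in breadth-first order.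
all-balanced-descending : VecAll.All Descending balancedGraphs
all-balanced-descending = toWitness {a? = VecAll.all? descending? balancedGraphs} tt

all-unbalanced-descending : VecAll.All Descending unbalancedGraphs
all-unbalanced-descending = toWitness {a? = VecAll.all? descending? unbalancedGraphs} tt

balanced-connected : ∀ i → Connected (lookup balancedGraphs i)
balanced-connected i =
  descending⇒connected (lookup balancedGraphs i) (All-lookup {P = Descending} all-balanced-descending i)

unbalanced-connected : ∀ i → Connected (lookup unbalancedGraphs i)
unbalanced-connected i =
  descending⇒connected (lookup unbalancedGraphs i) (All-lookup {P = Descending} all-unbalanced-descending i)

colouring : ∀ {n} → ℕ → Fin n → Fin 3
colouring c zero    = c mod 3
colouring c (suc i) = colouring (c / 3) i

-- Balanced colourings, read as ternary numbers with vertex 0 as the lowest digit.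
colourCodes : Vec ℕ 17
colourCodes =
    102648
  ∷ 220746
  ∷ 225120
  ∷ 225120
  ∷ 72030
  ∷ 85152
  ∷ 102648
  ∷ 299478
  ∷ 378210
  ∷ 76404
  ∷ 203292
  ∷ 194544
  ∷ 38376
  ∷ 37080
  ∷ 37080
  ∷ 76440
  ∷ 32706
  ∷ []

Balances : ∀ {n} → Graph n → (Fin n → Fin 3) → Set
Balances G ℓ = ∀ v → (colourCount G ℓ v zero ≡ colourCount G ℓ v (suc zero)) ×
                     (colourCount G ℓ v (suc zero) ≡ colourCount G ℓ v (suc (suc zero)))

balances? : ∀ {n} (G : Graph n) ℓ → Dec (Balances G ℓ)
balances? G ℓ = all? (λ v → (_ ℕ.≟ _) ×-dec (_ ℕ.≟ _))

all-balances : ∀ i → Balances (lookup balancedGraphs i) (colouring (lookup colourCodes i))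
all-balances =
  toWitness {a? = all? (λ i → balances? (lookup balancedGraphs i) (colouring (lookup colourCodes i)))} tt

balanced-balanced : ∀ i → ThreeBalanced (lookup balancedGraphs i)
balanced-balanced i = colouring (lookup colourCodes i) , all-balances i

all-no-colouring : VecAll.All NoColouring unbalancedGraphs
all-no-colouring = toWitness {a? = VecAll.all? noColouring? unbalancedGraphs} tt

unbalanced-unbalanced : ∀ i → ¬ ThreeBalanced (lookup unbalancedGraphs i)
unbalanced-unbalanced i = noColouring⇒unbalanced (lookup unbalancedGraphs i) (unbalanced-cubic i)
  (All-lookup {P = NoColouring} all-no-colouring i)

invariants-unique :
  Unique (Vec.map walkInvariant balancedGraphs Vec.++ Vec.map walkInvariant unbalancedGraphs)
invariants-unique = toWitness {a? = allPairs? (λ m k → ¬? (m ℕ.≟ k))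
  (Vec.map walkInvariant balancedGraphs Vec.++ Vec.map walkInvariant unbalancedGraphs)} tt

-- Completeness of the two lists

Listed : Graph 12 → Set
Listed G = (∃ λ i → Isomorphic G (lookup balancedGraphs i)) ⊎ (∃ λ j → Isomorphic G (lookup unbalancedGraphs j))

open Search Listed

-- A listed pattern is cubic, so each cubic host is isomorphic to it. The argument `listed` says on
-- which side of the disjunction the position belongs, which lets one proof serve both lists.
listed-settled : ∀ {k} (codes : Vec ℕ k) → let graphs = Vec.map (graph ∘ cubicPattern) codes in
  (∀ i → Cubic (lookup graphs i)) → (∀ G i → Isomorphic G (lookup graphs i) → Listed G) →
  ∀ i → Settled (cubicPattern (lookup codes i))
listed-settled codes cubic listed i G (_ , cubicG) P↪G =
  listed G i (subst (Isomorphic G) (sym eq)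
    (cubic↪⇒isomorphic {H = graph (cubicPattern (lookup codes i))} {G} cubicG P↪G (subst Cubic eq (cubic i))))
  where eq = lookup-map i (graph ∘ cubicPattern) codes

-- As the initial library, the 85 graphs are cited by `found` like any other settled pattern. Their
-- indices grow as entries are put in front of them.
listedPatterns : Library
listedPatterns =
  List.tabulate (λ i → cubicPattern (lookup balancedCodes i) ,
    listed-settled balancedCodes balanced-cubic (λ G i iso → inj₁ (i , iso)) i) List.++
  List.tabulate (λ j → cubicPattern (lookup unbalancedCodes j) ,
    listed-settled unbalancedCodes unbalanced-cubic (λ G j iso → inj₂ (j , iso)) j)

-- The three splits at 0 have one certified child each, since the neighbours of 0 may be called 1, 2
-- and 3. The first split at 1 has two: the edge to 2, which settles all graphs with a triangle, and
-- the edge to a new vertex 4. Below the second, adding the edge from 1 to 2 is `found 0` at once.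
-- The first `closed` is a complete graph on 0, 1, 2 and 3. A leaf `split v []` is a dead end: `v`
-- needs an edge and every partner is excluded.
certificate : Certificate
certificate =
  split 0 ((split 0 ((split 0 ((split 1 ((split 1 ((split 2 (closed ∷ (split 3 ((split 4 ((split 5 ((split 5
  ((split 6 ((split 6 ((split 7 ((split 8 ((split 9 ((split 9 ((split 10 ((split 10 []) ∷ [])) ∷ [])) ∷ [])) ∷
  [])) ∷ (split 8 ((split 8 ((split 9 ((split 10 ((split 11 []) ∷ [])) ∷ (split 10 ((split 10 []) ∷ [])) ∷ [])) ∷
  [])) ∷ (split 8 ((found 0 239500800) ∷ (split 9 ((split 9 ((split 10 ((found 29 0) ∷ [])) ∷ [])) ∷ [])) ∷ [])) ∷
  [])) ∷ [])) ∷ [])) ∷ (split 6 ((found 0 459043200) ∷ (split 7 ((split 7 ((split 8 (closed ∷ (split 9 ((split 10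
  ((split 11 []) ∷ [])) ∷ (split 10 ((split 10 []) ∷ [])) ∷ [])) ∷ [])) ∷ (split 8 ((split 9 ((split 10 ((split 11
  []) ∷ [])) ∷ (split 10 ((split 10 []) ∷ [])) ∷ [])) ∷ (found 0 80498880) ∷ (split 9 ((split 9 ((split 10 ((found
  49 0) ∷ [])) ∷ [])) ∷ (split 9 ((found 0 0) ∷ [])) ∷ [])) ∷ [])) ∷ [])) ∷ (split 7 ((found 0 239500800) ∷ (split
  8 ((split 8 ((split 9 ((split 11 []) ∷ (split 10 ((found 57 0) ∷ [])) ∷ [])) ∷ [])) ∷ (split 8 ((found 0
  239500800) ∷ (split 9 ((split 9 ((found 61 239500800) ∷ [])) ∷ [])) ∷ [])) ∷ [])) ∷ [])) ∷ [])) ∷ [])) ∷ [])) ∷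
  [])) ∷ [])) ∷ [])) ∷ (split 4 ((split 4 ((split 5 ((split 6 ((split 7 ((split 7 ((split 8 ((split 8 ((split 9
  ((split 10 ((split 11 []) ∷ [])) ∷ (split 10 ((split 10 []) ∷ [])) ∷ [])) ∷ [])) ∷ (split 8 ((found 0 239500800)
  ∷ (split 9 ((split 9 ((split 10 ((found 6 479001598) ∷ [])) ∷ [])) ∷ [])) ∷ [])) ∷ [])) ∷ [])) ∷ [])) ∷ [])) ∷
  (split 6 ((split 6 ((split 7 ((split 8 ((split 9 ((split 9 ((split 10 ((split 10 []) ∷ [])) ∷ [])) ∷ [])) ∷ []))
  ∷ (split 8 ((split 8 ((split 9 ((split 10 ((split 11 []) ∷ [])) ∷ (split 10 ((split 10 []) ∷ [])) ∷ [])) ∷ []))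
  ∷ (split 8 ((found 0 239500800) ∷ (split 9 ((split 9 ((split 10 ((found 98 0) ∷ [])) ∷ [])) ∷ [])) ∷ [])) ∷ []))
  ∷ [])) ∷ [])) ∷ (split 6 ((found 0 459043200) ∷ (split 7 ((split 7 ((split 8 (closed ∷ (split 9 ((split 10
  ((split 11 []) ∷ [])) ∷ (split 10 ((split 10 []) ∷ [])) ∷ [])) ∷ [])) ∷ (split 8 ((split 9 ((split 10 ((split 11
  []) ∷ [])) ∷ (split 10 ((split 10 []) ∷ [])) ∷ [])) ∷ (found 0 80510892) ∷ (split 9 ((split 9 ((split 10 ((found
  118 0) ∷ [])) ∷ [])) ∷ (split 9 ((found 0 0) ∷ [])) ∷ [])) ∷ [])) ∷ [])) ∷ (split 7 ((found 0 239500800) ∷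
  (split 8 ((split 8 ((split 9 ((split 11 []) ∷ (split 10 ((found 126 0) ∷ [])) ∷ [])) ∷ [])) ∷ (split 8 ((found 0
  0) ∷ (split 9 ((split 9 ((found 130 0) ∷ [])) ∷ [])) ∷ [])) ∷ [])) ∷ [])) ∷ [])) ∷ [])) ∷ [])) ∷ [])) ∷ [])) ∷
  (split 4 ((found 0 478336320) ∷ (split 5 ((split 5 ((split 6 (closed ∷ (split 7 ((split 8 ((split 9 ((split 9
  ((split 10 ((split 10 []) ∷ [])) ∷ [])) ∷ [])) ∷ [])) ∷ (split 8 ((split 8 ((split 9 ((split 10 ((split 11 []) ∷
  [])) ∷ (split 10 ((split 10 []) ∷ [])) ∷ [])) ∷ [])) ∷ (split 8 ((found 0 260124480) ∷ (split 9 ((split 9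
  ((split 10 ((found 153 260124480) ∷ [])) ∷ [])) ∷ [])) ∷ [])) ∷ [])) ∷ [])) ∷ [])) ∷ (split 6 ((split 7 ((split
  8 ((split 9 ((split 9 ((split 10 ((split 10 []) ∷ [])) ∷ [])) ∷ [])) ∷ [])) ∷ (split 8 ((split 8 ((split 9
  ((split 10 ((split 11 []) ∷ [])) ∷ (split 10 ((split 10 []) ∷ [])) ∷ [])) ∷ [])) ∷ (split 8 ((found 0 239500800)
  ∷ (split 9 ((split 9 ((split 10 ((found 172 0) ∷ [])) ∷ [])) ∷ [])) ∷ [])) ∷ [])) ∷ [])) ∷ (found 0 403171692) ∷
  (split 7 ((split 7 ((split 8 (closed ∷ (split 9 ((split 10 ((split 11 []) ∷ [])) ∷ (split 10 ((split 10 []) ∷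
  [])) ∷ [])) ∷ [])) ∷ (split 8 ((found 0 243504492) ∷ (split 9 ((split 9 ((split 11 []) ∷ [])) ∷ (split 9 ((found
  0 0) ∷ [])) ∷ [])) ∷ (split 9 ((split 9 ((split 10 ((found 190 0) ∷ [])) ∷ [])) ∷ (found 0 243504492) ∷ [])) ∷
  [])) ∷ [])) ∷ (split 7 ((found 0 239500800) ∷ (split 8 ((split 8 ((split 10 ((split 11 []) ∷ [])) ∷ (split 10
  ((split 10 []) ∷ [])) ∷ [])) ∷ (split 8 ((found 0 0) ∷ (split 9 ((split 11 []) ∷ (split 10 ((found 202 0) ∷ []))
  ∷ [])) ∷ [])) ∷ (split 8 ((found 4 0) ∷ (found 0 0) ∷ [])) ∷ [])) ∷ [])) ∷ (split 7 ((found 12 239500800) ∷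
  (found 0 239500800) ∷ (split 8 ((found 0 243504492) ∷ (split 8 ((found 0 243504492) ∷ (split 9 ((split 9 ((found
  209 0) ∷ [])) ∷ [])) ∷ [])) ∷ [])) ∷ [])) ∷ [])) ∷ [])) ∷ [])) ∷ (split 5 ((found 0 459043200) ∷ (split 6
  ((split 6 ((split 7 ((split 9 ((split 9 ((split 10 ((split 10 []) ∷ [])) ∷ [])) ∷ [])) ∷ (split 8 (closed ∷
  (split 9 ((split 10 ((split 11 []) ∷ [])) ∷ (split 10 ((split 10 []) ∷ [])) ∷ [])) ∷ [])) ∷ (split 8 ((split 9
  ((split 10 ((split 11 []) ∷ [])) ∷ (split 10 ((split 10 []) ∷ [])) ∷ [])) ∷ (split 9 ((split 9 ((split 11 []) ∷
  [])) ∷ (split 9 ((found 0 0) ∷ [])) ∷ [])) ∷ (split 9 ((split 9 ((split 10 ((found 238 0) ∷ [])) ∷ [])) ∷ (split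
  9 ((found 0 0) ∷ [])) ∷ [])) ∷ [])) ∷ [])) ∷ (split 7 ((found 0 240166080) ∷ (split 8 ((split 8 ((split 9
  ((split 11 []) ∷ [])) ∷ (split 9 ((found 0 20623680) ∷ (split 10 ((found 248 665280) ∷ [])) ∷ [])) ∷ [])) ∷
  (split 8 ((found 0 665280) ∷ (split 9 ((split 9 []) ∷ [])) ∷ [])) ∷ (split 8 ((found 3 665280) ∷ (found 0
  665280) ∷ [])) ∷ [])) ∷ (split 8 ((split 8 ((split 9 ((found 0 29284332) ∷ (split 10 ((found 257 260124480) ∷
  [])) ∷ [])) ∷ (found 0 240166080) ∷ [])) ∷ (split 8 ((found 0 240166080) ∷ (split 9 ((split 9 ((found 261
  240166080) ∷ [])) ∷ (found 0 240166080) ∷ [])) ∷ [])) ∷ (found 0 240166080) ∷ [])) ∷ [])) ∷ [])) ∷ (split 6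
  ((found 0 240166080) ∷ (split 7 ((split 7 (closed ∷ (split 9 ((split 10 ((split 11 []) ∷ [])) ∷ (split 10
  ((split 10 []) ∷ [])) ∷ [])) ∷ [])) ∷ (split 7 ((found 0 239500800) ∷ (split 8 ((found 7 268785132) ∷ (split 9
  ((split 11 []) ∷ (split 10 ((found 272 0) ∷ [])) ∷ [])) ∷ [])) ∷ [])) ∷ [])) ∷ (split 7 ((found 0 268785132) ∷
  (split 7 ((found 0 240166080) ∷ (split 8 ((found 13 268785132) ∷ (split 9 ((split 11 []) ∷ [])) ∷ (split 9
  ((found 0 20623680) ∷ (split 10 ((found 283 20623680) ∷ [])) ∷ [])) ∷ [])) ∷ (split 8 ((found 18 268785132) ∷
  (split 9 ((found 0 9325932) ∷ (split 10 ((found 287 260124480) ∷ [])) ∷ [])) ∷ (split 9 ((split 10 ((found 290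
  260124480) ∷ [])) ∷ (found 1 260124480) ∷ [])) ∷ [])) ∷ [])) ∷ (split 7 ((found 11 268785132) ∷ (found 0
  20623680) ∷ (split 8 ((found 24 268785132) ∷ (split 9 ((split 9 []) ∷ [])) ∷ (split 9 ((split 9 ((found 297 0) ∷
  [])) ∷ (split 9 ((found 0 0) ∷ [])) ∷ [])) ∷ [])) ∷ [])) ∷ (split 7 ((found 18 268785132) ∷ (found 7 260124480)
  ∷ (found 0 0) ∷ [])) ∷ [])) ∷ [])) ∷ (split 6 ((found 34 240166080) ∷ (found 0 239500800) ∷ (split 7 ((found 0
  240166080) ∷ (split 7 ((found 0 240166080) ∷ (split 8 ((found 34 268785132) ∷ (split 8 ((found 34 268785132) ∷
  (split 9 []) ∷ [])) ∷ [])) ∷ [])) ∷ [])) ∷ [])) ∷ [])) ∷ [])) ∷ [])) ∷ [])) ∷ [])) ∷ [])) ∷ [])) ∷ (split 2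
  ((found 0 478989732) ∷ (found 0 478991053) ∷ (split 3 ((split 3 ((split 4 (closed ∷ (split 5 ((split 6 ((split 7
  ((split 7 ((split 8 ((split 8 ((split 9 ((found 1 479000120) ∷ (split 10 ((split 10 []) ∷ [])) ∷ [])) ∷ [])) ∷
  (split 8 ((found 0 239500800) ∷ (split 9 ((split 9 ((split 10 ((found 5 479001466) ∷ [])) ∷ [])) ∷ [])) ∷ [])) ∷
  [])) ∷ [])) ∷ [])) ∷ [])) ∷ (split 6 ((split 6 ((split 7 ((split 8 ((split 9 ((split 9 ((split 10 ((split 10 [])
  ∷ [])) ∷ [])) ∷ [])) ∷ [])) ∷ (split 8 ((split 8 ((split 9 ((split 10 ((split 11 []) ∷ [])) ∷ (split 10 ((split
  10 []) ∷ [])) ∷ [])) ∷ [])) ∷ (split 8 ((found 0 239500800) ∷ (split 9 ((split 9 ((split 10 ((found 24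
  479001466) ∷ [])) ∷ [])) ∷ [])) ∷ [])) ∷ [])) ∷ [])) ∷ [])) ∷ (split 6 ((found 0 459043200) ∷ (split 7 ((split 7
  ((split 8 ((found 31 478998668) ∷ (split 9 ((split 10 ((split 11 []) ∷ [])) ∷ (split 10 ((split 10 []) ∷ [])) ∷
  [])) ∷ [])) ∷ (split 8 ((split 9 ((split 10 ((split 11 []) ∷ [])) ∷ (split 10 ((split 10 []) ∷ [])) ∷ [])) ∷
  (found 0 80510772) ∷ (split 9 ((split 9 ((split 10 ((found 322 0) ∷ [])) ∷ [])) ∷ (split 9 ((found 0 0) ∷ [])) ∷
  [])) ∷ [])) ∷ [])) ∷ (split 7 ((found 0 239500800) ∷ (split 8 ((split 8 ((split 9 ((found 48 478999856) ∷ (split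
  10 ((found 367 259459200) ∷ [])) ∷ [])) ∷ [])) ∷ (split 8 ((found 0 259459200) ∷ (split 9 ((split 9 ((found 332
  259459200) ∷ [])) ∷ [])) ∷ [])) ∷ [])) ∷ [])) ∷ [])) ∷ [])) ∷ [])) ∷ [])) ∷ [])) ∷ (split 4 ((found 0 478337641)
  ∷ (split 5 ((split 5 ((split 7 ((split 7 ((split 8 ((split 8 ((split 9 ((found 61 478999988) ∷ (split 10 ((split
  10 []) ∷ [])) ∷ [])) ∷ [])) ∷ (split 8 ((found 0 239500800) ∷ (split 9 ((split 9 ((split 10 ((found 65
  479001598) ∷ [])) ∷ [])) ∷ [])) ∷ [])) ∷ [])) ∷ [])) ∷ [])) ∷ [])) ∷ (split 5 ((found 0 475009920) ∷ (split 6
  ((split 7 ((split 8 ((split 9 ((split 9 ((split 10 ((split 10 []) ∷ [])) ∷ [])) ∷ [])) ∷ [])) ∷ (split 8 ((split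
  8 ((split 9 ((split 10 ((split 11 []) ∷ [])) ∷ (split 10 ((split 10 []) ∷ [])) ∷ [])) ∷ [])) ∷ (split 8 ((found
  0 239500800) ∷ (split 9 ((split 9 ((split 10 ((found 84 479001598) ∷ [])) ∷ [])) ∷ [])) ∷ [])) ∷ [])) ∷ [])) ∷
  (split 7 ((split 7 ((split 8 ((found 90 478998391) ∷ (split 9 ((split 10 ((split 11 []) ∷ [])) ∷ (split 10
  ((split 10 []) ∷ [])) ∷ [])) ∷ [])) ∷ (split 8 ((found 0 243492480) ∷ (found 96 478999711) ∷ (split 9 ((split 9
  ((split 10 ((found 378 243492480) ∷ [])) ∷ [])) ∷ (found 0 243492480) ∷ [])) ∷ [])) ∷ [])) ∷ (split 7 ((found 0
  243492480) ∷ (split 8 ((split 8 ((split 10 ((split 11 []) ∷ [])) ∷ (split 10 ((split 10 []) ∷ [])) ∷ [])) ∷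
  (split 8 ((found 0 3991680) ∷ (split 9 ((found 5 271814967) ∷ (split 10 ((found 45 478905106) ∷ [])) ∷ [])) ∷
  [])) ∷ (split 8 ((found 3 243492480) ∷ (found 0 0) ∷ [])) ∷ [])) ∷ [])) ∷ (split 7 ((found 11 243492480) ∷
  (found 0 239500800) ∷ (split 8 ((found 0 243492480) ∷ (split 8 ((found 0 243492480) ∷ (split 9 ((split 9 ((found
  395 243492480) ∷ [])) ∷ [])) ∷ [])) ∷ [])) ∷ [])) ∷ [])) ∷ [])) ∷ [])) ∷ [])) ∷ (split 5 ((split 5 ((split 6
  (closed ∷ (split 7 ((split 8 ((split 9 ((split 9 ((split 10 ((split 10 []) ∷ [])) ∷ [])) ∷ [])) ∷ [])) ∷ (split
  8 ((split 8 ((split 9 ((split 10 ((split 11 []) ∷ [])) ∷ (split 10 ((split 10 []) ∷ [])) ∷ [])) ∷ [])) ∷ (split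
  8 ((found 0 239500800) ∷ (split 9 ((split 9 ((split 10 ((found 133 479001598) ∷ [])) ∷ [])) ∷ [])) ∷ [])) ∷ []))
  ∷ [])) ∷ [])) ∷ (split 6 ((split 7 ((split 8 ((split 9 ((split 9 ((split 10 ((split 10 []) ∷ [])) ∷ [])) ∷ []))
  ∷ [])) ∷ (split 8 ((split 8 ((split 9 ((split 10 ((split 11 []) ∷ [])) ∷ (split 10 ((split 10 []) ∷ [])) ∷ []))
  ∷ [])) ∷ (split 8 ((found 0 239500800) ∷ (split 9 ((split 9 ((split 10 ((found 151 479001598) ∷ [])) ∷ [])) ∷
  [])) ∷ [])) ∷ [])) ∷ [])) ∷ (split 7 ((split 7 ((split 9 ((split 9 ((split 10 ((split 10 []) ∷ [])) ∷ [])) ∷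
  [])) ∷ [])) ∷ (split 7 ((found 0 399168000) ∷ (split 8 ((split 9 ((split 10 ((split 11 []) ∷ [])) ∷ (split 10
  ((split 10 []) ∷ [])) ∷ [])) ∷ (split 9 ((split 9 ((split 10 ((found 167 479001321) ∷ [])) ∷ [])) ∷ (split 9
  ((found 0 79833600) ∷ [])) ∷ [])) ∷ [])) ∷ [])) ∷ [])) ∷ (split 7 ((split 7 ((split 8 (closed ∷ (split 9 ((split
  10 ((split 11 []) ∷ [])) ∷ (split 10 ((split 10 []) ∷ [])) ∷ [])) ∷ [])) ∷ (split 8 ((split 9 ((split 10 ((split
  11 []) ∷ [])) ∷ (split 10 ((split 10 []) ∷ [])) ∷ [])) ∷ (split 9 ((split 9 ((split 11 []) ∷ [])) ∷ (split 9
  ((found 0 0) ∷ [])) ∷ [])) ∷ (split 9 ((split 9 ((split 10 ((found 510 0) ∷ [])) ∷ [])) ∷ (split 9 ((found 0 0)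
  ∷ [])) ∷ [])) ∷ [])) ∷ [])) ∷ (split 7 ((found 0 239500800) ∷ (split 8 ((split 8 ((split 10 ((split 11 []) ∷
  [])) ∷ (split 10 ((split 10 []) ∷ [])) ∷ [])) ∷ (split 8 ((found 0 0) ∷ (split 9 ((split 11 []) ∷ (split 10
  ((found 523 0) ∷ [])) ∷ [])) ∷ [])) ∷ (split 8 ((found 4 0) ∷ (found 0 0) ∷ [])) ∷ [])) ∷ [])) ∷ (split 7
  ((found 12 239500800) ∷ (found 0 239500800) ∷ (split 8 ((split 8 ((split 9 ((split 11 []) ∷ (split 10 ((found
  531 0) ∷ [])) ∷ [])) ∷ [])) ∷ (split 8 ((found 0 0) ∷ (split 9 ((split 9 ((found 535 0) ∷ [])) ∷ [])) ∷ [])) ∷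
  [])) ∷ [])) ∷ [])) ∷ [])) ∷ [])) ∷ (found 0 459709801) ∷ (split 5 ((found 0 459043200) ∷ (found 0 459709801) ∷
  (split 6 ((split 6 ((split 7 ((split 9 ((split 9 ((split 10 ((split 10 []) ∷ [])) ∷ [])) ∷ [])) ∷ (split 8
  (closed ∷ (split 9 ((split 10 ((split 11 []) ∷ [])) ∷ (split 10 ((split 10 []) ∷ [])) ∷ [])) ∷ [])) ∷ (split 8
  ((split 9 ((split 10 ((split 11 []) ∷ [])) ∷ (split 10 ((split 10 []) ∷ [])) ∷ [])) ∷ (split 9 ((split 9 ((split
  11 []) ∷ [])) ∷ (split 9 ((found 0 0) ∷ [])) ∷ [])) ∷ (split 9 ((split 9 ((split 10 ((found 20 470994467) ∷ []))
  ∷ [])) ∷ (split 9 ((found 0 0) ∷ [])) ∷ [])) ∷ [])) ∷ [])) ∷ (split 7 ((found 0 240167401) ∷ (split 8 ((split 8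
  ((split 9 ((split 11 []) ∷ [])) ∷ (split 9 ((found 0 19958400) ∷ (found 248 479001044) ∷ [])) ∷ [])) ∷ (split 8
  ((found 0 0) ∷ (split 9 ((split 9 []) ∷ [])) ∷ [])) ∷ (split 8 ((found 3 0) ∷ (found 0 0) ∷ [])) ∷ [])) ∷ (split
  8 ((split 8 ((split 9 ((found 255 478999724) ∷ (split 10 ((found 539 0) ∷ [])) ∷ [])) ∷ (found 0 240167401) ∷
  [])) ∷ (split 8 ((found 0 0) ∷ (split 9 ((split 9 ((found 543 0) ∷ [])) ∷ (found 0 240167401) ∷ [])) ∷ [])) ∷
  (found 0 240167401) ∷ [])) ∷ [])) ∷ [])) ∷ (split 6 ((found 0 239500800) ∷ (split 7 ((split 7 (closed ∷ (split 9
  ((split 10 ((split 11 []) ∷ [])) ∷ (split 10 ((split 10 []) ∷ [])) ∷ [])) ∷ [])) ∷ (split 7 ((found 0 239500800)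
  ∷ (split 8 ((found 271 478997216) ∷ (split 9 ((split 11 []) ∷ (split 10 ((found 596 0) ∷ [])) ∷ [])) ∷ [])) ∷
  [])) ∷ [])) ∷ (split 7 ((split 7 ((found 0 240167401) ∷ (split 9 ((split 9 ((split 11 []) ∷ [])) ∷ (split 9
  ((found 0 0) ∷ [])) ∷ [])) ∷ (split 9 ((split 9 ((split 10 ((found 607 0) ∷ [])) ∷ [])) ∷ (found 0 240167401) ∷
  [])) ∷ [])) ∷ (split 7 ((found 0 0) ∷ (split 8 ((split 10 ((split 11 []) ∷ [])) ∷ (split 9 ((split 11 []) ∷ []))
  ∷ (split 9 ((found 0 20625001) ∷ (split 10 ((found 614 0) ∷ [])) ∷ [])) ∷ [])) ∷ (split 8 ((split 10 ((split 10
  []) ∷ [])) ∷ (split 9 ((split 11 []) ∷ (split 10 ((found 622 0) ∷ [])) ∷ [])) ∷ (split 9 ((split 10 ((found 625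
  0) ∷ [])) ∷ (found 1 260125801) ∷ [])) ∷ [])) ∷ [])) ∷ (split 7 ((found 16 0) ∷ (found 0 0) ∷ (split 8 ((split 9
  ((split 11 []) ∷ (split 10 ((found 631 0) ∷ [])) ∷ [])) ∷ (split 9 ((split 9 []) ∷ [])) ∷ (split 9 ((split 9
  ((found 636 0) ∷ [])) ∷ (split 9 ((found 0 0) ∷ [])) ∷ [])) ∷ [])) ∷ [])) ∷ (split 7 ((found 26 0) ∷ (found 10
  0) ∷ (found 0 0) ∷ [])) ∷ [])) ∷ [])) ∷ (split 6 ((found 50 239500800) ∷ (found 0 239500800) ∷ (split 7 ((found
  0 240167401) ∷ (split 7 ((found 0 240167401) ∷ (split 8 ((split 8 ((split 9 ((found 645 259459200) ∷ [])) ∷ []))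
  ∷ (split 8 ((found 0 0) ∷ (split 9 []) ∷ [])) ∷ [])) ∷ [])) ∷ [])) ∷ [])) ∷ [])) ∷ [])) ∷ [])) ∷ [])) ∷ [])) ∷
  (found 0 478348212) ∷ (split 3 ((found 0 478336320) ∷ (found 0 478348212) ∷ (split 4 ((found 0 478349533) ∷
  (split 4 ((found 0 478349533) ∷ (split 5 ((split 5 (closed ∷ (split 7 ((split 8 ((split 9 ((split 9 ((split 10
  ((split 10 []) ∷ [])) ∷ [])) ∷ [])) ∷ [])) ∷ (split 8 ((split 8 ((split 9 ((split 10 ((split 11 []) ∷ [])) ∷
  (split 10 ((split 10 []) ∷ [])) ∷ [])) ∷ [])) ∷ (split 8 ((found 0 239500800) ∷ (split 9 ((split 9 ((split 10
  ((found 339 479001598) ∷ [])) ∷ [])) ∷ [])) ∷ [])) ∷ [])) ∷ [])) ∷ [])) ∷ (split 5 ((found 0 459043200) ∷ (split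
  6 ((found 346 478994154) ∷ (split 7 ((split 9 ((split 9 ((split 10 ((split 10 []) ∷ [])) ∷ [])) ∷ [])) ∷ (split
  8 (closed ∷ (split 9 ((split 10 ((split 11 []) ∷ [])) ∷ (split 10 ((split 10 []) ∷ [])) ∷ [])) ∷ [])) ∷ (split 8
  ((split 9 ((split 10 ((split 11 []) ∷ [])) ∷ (split 10 ((split 10 []) ∷ [])) ∷ [])) ∷ (split 9 ((split 9 ((split
  11 []) ∷ [])) ∷ (split 9 ((found 0 0) ∷ [])) ∷ [])) ∷ (split 9 ((split 9 ((split 10 ((found 39 478997637) ∷ []))
  ∷ [])) ∷ (split 9 ((found 0 0) ∷ [])) ∷ [])) ∷ [])) ∷ [])) ∷ (split 7 ((found 0 240166080) ∷ (split 8 ((split 8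
  ((split 9 ((split 11 []) ∷ [])) ∷ (split 9 ((found 0 19958400) ∷ (found 374 479001044) ∷ [])) ∷ [])) ∷ (split 8
  ((found 0 19958400) ∷ (split 9 ((split 9 []) ∷ [])) ∷ [])) ∷ (split 8 ((found 3 19958400) ∷ (found 0 0) ∷ [])) ∷
  [])) ∷ (split 8 ((split 8 ((split 9 ((found 381 478997480) ∷ (split 10 ((found 54 478619564) ∷ [])) ∷ [])) ∷
  (found 0 240166080) ∷ [])) ∷ (split 8 ((found 0 19958400) ∷ (split 9 ((split 9 ((found 716 19958400) ∷ [])) ∷
  (found 0 240166080) ∷ [])) ∷ [])) ∷ (found 0 240166080) ∷ [])) ∷ [])) ∷ [])) ∷ [])) ∷ [])) ∷ (split 5 ((split 5
  ((found 0 459055092) ∷ (found 0 463048093) ∷ (split 7 ((split 7 ((split 8 (closed ∷ (split 9 ((split 10 ((split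
  11 []) ∷ [])) ∷ (split 10 ((split 10 []) ∷ [])) ∷ [])) ∷ [])) ∷ (split 8 ((found 0 243493801) ∷ (split 9 ((split
  9 ((split 11 []) ∷ [])) ∷ (split 9 ((found 0 0) ∷ [])) ∷ [])) ∷ (split 9 ((split 9 ((split 10 ((found 76
  478905238) ∷ [])) ∷ [])) ∷ (found 0 243493801) ∷ [])) ∷ [])) ∷ [])) ∷ (found 0 259471092) ∷ (split 7 ((found 0
  239500800) ∷ (found 0 259471092) ∷ (split 8 ((found 0 263464093) ∷ (split 8 ((found 0 263464093) ∷ (split 9
  ((split 9 ((found 741 239500800) ∷ [])) ∷ [])) ∷ [])) ∷ [])) ∷ [])) ∷ [])) ∷ [])) ∷ (split 5 ((found 0
  399168000) ∷ (split 6 ((split 8 ((split 9 ((split 9 ((split 10 ((split 10 []) ∷ [])) ∷ [])) ∷ [])) ∷ [])) ∷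
  (found 0 403161001) ∷ (split 7 ((found 0 403827602) ∷ (split 8 (closed ∷ (split 9 ((split 10 ((split 11 []) ∷
  [])) ∷ (split 10 ((split 10 []) ∷ [])) ∷ [])) ∷ [])) ∷ (split 8 ((found 0 243493801) ∷ (found 0 323994002) ∷
  (split 9 ((split 9 ((split 10 ((found 713 0) ∷ [])) ∷ [])) ∷ (found 0 243493801) ∷ [])) ∷ [])) ∷ [])) ∷ [])) ∷
  (split 6 ((split 8 ((split 8 ((split 9 ((split 10 ((split 11 []) ∷ [])) ∷ (split 10 ((split 10 []) ∷ [])) ∷ []))
  ∷ [])) ∷ (split 8 ((found 0 239500800) ∷ (split 9 ((split 9 ((split 10 ((found 439 479001466) ∷ [])) ∷ [])) ∷
  [])) ∷ [])) ∷ [])) ∷ (split 7 ((found 117 478483458) ∷ (split 8 (closed ∷ (split 9 ((split 10 ((split 11 []) ∷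
  [])) ∷ (split 10 ((split 10 []) ∷ [])) ∷ [])) ∷ [])) ∷ (split 8 ((split 9 ((split 10 ((split 11 []) ∷ [])) ∷
  (split 10 ((split 10 []) ∷ [])) ∷ [])) ∷ (split 9 ((split 9 ((split 11 []) ∷ [])) ∷ (split 9 ((found 0 0) ∷ []))
  ∷ [])) ∷ (split 9 ((split 9 ((split 10 ((found 133 478985745) ∷ [])) ∷ [])) ∷ (split 9 ((found 0 0) ∷ [])) ∷
  [])) ∷ [])) ∷ [])) ∷ (split 7 ((split 8 (closed ∷ (split 9 ((split 10 ((split 11 []) ∷ [])) ∷ (split 10 ((split
  10 []) ∷ [])) ∷ [])) ∷ [])) ∷ (found 7 260136372) ∷ (split 8 ((split 8 ((split 10 ((split 11 []) ∷ [])) ∷ (split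
  10 ((split 10 []) ∷ [])) ∷ [])) ∷ (split 8 ((found 0 0) ∷ (split 9 ((split 11 []) ∷ (split 10 ((found 813 0) ∷
  [])) ∷ [])) ∷ [])) ∷ (split 8 ((found 4 0) ∷ (found 0 0) ∷ [])) ∷ [])) ∷ [])) ∷ (split 7 ((found 0 260136372) ∷
  (found 19 260136372) ∷ (split 8 ((split 8 ((split 9 ((split 11 []) ∷ [])) ∷ (split 9 ((found 0 20635572) ∷
  (split 10 ((found 822 0) ∷ [])) ∷ [])) ∷ [])) ∷ (split 8 ((found 0 0) ∷ (split 9 ((split 9 []) ∷ [])) ∷ [])) ∷
  (split 8 ((found 3 0) ∷ (found 0 0) ∷ [])) ∷ [])) ∷ (split 8 ((split 8 ((split 9 ((found 168 478782332) ∷ (split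
  10 ((found 782 0) ∷ [])) ∷ [])) ∷ (split 9 ((split 10 ((found 833 0) ∷ [])) ∷ (found 1 260136372) ∷ [])) ∷ []))
  ∷ (split 8 ((found 0 0) ∷ (split 9 ((split 9 ((found 837 0) ∷ [])) ∷ (split 9 ((found 0 0) ∷ [])) ∷ [])) ∷ []))
  ∷ (split 8 ((found 4 0) ∷ (found 0 0) ∷ [])) ∷ [])) ∷ [])) ∷ [])) ∷ [])) ∷ (found 0 403161001) ∷ (split 5
  ((found 94 399168000) ∷ (found 0 399168000) ∷ (found 0 403161001) ∷ (split 6 ((split 7 ((found 182 478388274) ∷
  (split 8 ((found 0 407536182) ∷ (split 8 ((found 0 407536182) ∷ (split 9 ((split 11 []) ∷ (split 10 ((found 183
  478807426) ∷ [])) ∷ [])) ∷ [])) ∷ (split 8 ((found 4 407536182) ∷ (found 0 0) ∷ [])) ∷ [])) ∷ (split 8 ((split 8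
  ((split 9 ((found 515 478997493) ∷ (split 10 ((found 853 0) ∷ [])) ∷ [])) ∷ (found 8 407726262) ∷ [])) ∷ (found
  9 407726262) ∷ [])) ∷ [])) ∷ (found 0 3993001) ∷ (split 7 ((split 7 ((split 8 ((split 10 ((split 11 []) ∷ [])) ∷
  (split 10 ((split 10 []) ∷ [])) ∷ [])) ∷ (split 8 ((found 0 3993001) ∷ (split 9 ((split 11 []) ∷ [])) ∷ (split 9
  ((split 11 []) ∷ (split 10 ((found 867 0) ∷ [])) ∷ [])) ∷ [])) ∷ (split 8 ((found 6 3993001) ∷ (found 0 3993001)
  ∷ (split 9 ((split 10 ((found 871 0) ∷ [])) ∷ (found 117 402345199) ∷ [])) ∷ [])) ∷ [])) ∷ (split 7 ((found 0 0)
  ∷ (split 8 ((split 8 ((split 11 []) ∷ [])) ∷ (split 8 ((found 0 0) ∷ [])) ∷ [])) ∷ (split 8 ((split 8 ((split 10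
  ((found 880 0) ∷ [])) ∷ [])) ∷ (split 8 ((found 0 0) ∷ [])) ∷ [])) ∷ [])) ∷ (split 7 ((found 9 0) ∷ (found 0 0)
  ∷ (split 8 ((found 0 3993001) ∷ (split 8 ((found 0 3993001) ∷ (split 9 ((found 886 0) ∷ [])) ∷ [])) ∷ (split 8
  ((found 2 3993001) ∷ (found 0 0) ∷ [])) ∷ [])) ∷ [])) ∷ (split 7 ((found 14 0) ∷ (found 5 0) ∷ (found 0 0) ∷
  [])) ∷ [])) ∷ (split 7 ((split 7 ((split 8 ((split 10 ((split 10 []) ∷ [])) ∷ (split 9 ((found 226 478606377) ∷
  (split 10 ((found 896 0) ∷ [])) ∷ [])) ∷ (split 9 ((split 10 ((found 899 0) ∷ [])) ∷ (split 10 []) ∷ [])) ∷ []))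
  ∷ (split 8 ((found 0 3993001) ∷ (found 232 478685851) ∷ [])) ∷ [])) ∷ (split 7 ((found 0 0) ∷ (split 8 ((split 8
  ((split 11 []) ∷ (split 10 ((found 907 0) ∷ [])) ∷ [])) ∷ (split 8 ((found 0 0) ∷ [])) ∷ [])) ∷ (split 8 ((split
  8 ((found 0 3993001) ∷ (split 10 []) ∷ [])) ∷ (split 8 ((found 0 0) ∷ (split 9 ((found 856 0) ∷ [])) ∷ [])) ∷
  (split 8 ((found 2 0) ∷ (found 0 0) ∷ [])) ∷ [])) ∷ [])) ∷ (split 7 ((found 12 0) ∷ (found 0 0) ∷ [])) ∷ [])) ∷
  [])) ∷ [])) ∷ [])) ∷ [])) ∷ (split 4 ((found 252 478349533) ∷ (found 0 459043200) ∷ (split 5 ((found 0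
  459055092) ∷ (found 0 468370333) ∷ (split 5 ((found 0 459055092) ∷ (found 0 468370333) ∷ (split 6 ((split 6
  ((split 7 ((found 579 478996794) ∷ (split 8 ((found 252 478402794) ∷ (found 0 472415274) ∷ [])) ∷ (split 8
  ((split 9 ((found 1 469766034) ∷ (split 10 ((found 869 0) ∷ [])) ∷ [])) ∷ (found 255 478414674) ∷ (split 9
  ((split 9 ((found 928 0) ∷ [])) ∷ (split 9 ((found 0 0) ∷ [])) ∷ [])) ∷ [])) ∷ [])) ∷ (found 0 199595892) ∷ []))
  ∷ (split 6 ((found 0 239500800) ∷ (split 7 ((split 7 ((split 10 ((found 0 19295762) ∷ [])) ∷ (split 9 ((split 11
  []) ∷ (split 10 ((found 2 19295762) ∷ [])) ∷ [])) ∷ [])) ∷ (split 7 ((found 0 239500800) ∷ (split 8 ((found 5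
  248816041) ∷ (split 9 ((found 940 0) ∷ [])) ∷ [])) ∷ [])) ∷ [])) ∷ (split 7 ((found 0 248816041) ∷ (split 7
  ((found 0 240166080) ∷ (found 0 18630482) ∷ (split 8 ((found 9 248816041) ∷ (split 9 ((found 945 0) ∷ [])) ∷
  (split 9 ((found 947 0) ∷ [])) ∷ [])) ∷ [])) ∷ (found 4 18630482) ∷ (found 0 199595892) ∷ [])) ∷ [])) ∷ (found 0
  199595892) ∷ [])) ∷ [])) ∷ [])) ∷ [])) ∷ [])) ∷ [])) ∷ [])) ∷ [])) ∷ [])) ∷ (split 1 ((found 0 478989720) ∷
  (split 2 ((found 0 478989864) ∷ (split 2 ((found 0 478989864) ∷ (split 3 ((split 3 (closed ∷ (split 5 ((split 6
  ((split 7 ((split 7 ((split 8 ((found 1 478998655) ∷ (split 8 ((found 1 478998655) ∷ (split 9 ((split 9 ((split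
  10 ((found 1 479000264) ∷ [])) ∷ [])) ∷ [])) ∷ [])) ∷ [])) ∷ [])) ∷ [])) ∷ [])) ∷ (split 6 ((split 6 ((split 7
  ((found 9 478994550) ∷ (split 8 ((split 8 ((split 9 ((found 9 478998800) ∷ (split 10 ((split 10 []) ∷ [])) ∷
  [])) ∷ [])) ∷ (split 8 ((found 0 239500800) ∷ (split 9 ((split 9 ((split 10 ((found 13 478998944) ∷ [])) ∷ []))
  ∷ [])) ∷ [])) ∷ [])) ∷ [])) ∷ [])) ∷ (split 6 ((found 0 459043200) ∷ (split 7 ((split 7 ((split 8 ((found 20
  478994706) ∷ (split 9 ((split 10 ((split 11 []) ∷ [])) ∷ (split 10 ((split 10 []) ∷ [])) ∷ [])) ∷ [])) ∷ (split
  8 ((found 26 478994706) ∷ (found 26 478997467) ∷ (split 9 ((split 9 ((split 10 ((found 26 478998957) ∷ [])) ∷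
  [])) ∷ (split 9 ((found 0 0) ∷ [])) ∷ [])) ∷ [])) ∷ [])) ∷ (split 7 ((found 0 239500800) ∷ (split 8 ((found 32
  478994706) ∷ (split 8 ((found 32 478994706) ∷ (split 9 ((split 9 ((found 934 259459200) ∷ [])) ∷ [])) ∷ [])) ∷
  [])) ∷ [])) ∷ [])) ∷ [])) ∷ [])) ∷ [])) ∷ [])) ∷ (split 3 ((found 0 478336320) ∷ (split 4 ((found 42 478990153)
  ∷ (split 5 ((found 0 478431793) ∷ (split 6 ((found 42 478990443) ∷ (split 7 ((split 8 ((split 9 ((split 9
  ((split 10 ((found 42 479001585) ∷ [])) ∷ [])) ∷ [])) ∷ [])) ∷ (split 8 ((split 8 ((split 9 ((found 46
  478998812) ∷ (split 10 ((split 10 []) ∷ [])) ∷ [])) ∷ [])) ∷ (split 8 ((found 0 239500800) ∷ (split 9 ((split 9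
  ((split 10 ((found 50 478998944) ∷ [])) ∷ [])) ∷ [])) ∷ [])) ∷ [])) ∷ [])) ∷ [])) ∷ (split 6 ((found 57
  478990443) ∷ (found 0 463134028) ∷ (split 7 ((split 7 ((split 8 ((found 57 478994695) ∷ (split 9 ((split 10
  ((split 11 []) ∷ [])) ∷ (split 10 ((split 10 []) ∷ [])) ∷ [])) ∷ [])) ∷ (split 8 ((split 9 ((split 10 ((split 11
  []) ∷ [])) ∷ (split 10 ((split 10 []) ∷ [])) ∷ [])) ∷ (found 68 478994827) ∷ (split 9 ((split 9 ((split 10
  ((found 68 478998945) ∷ [])) ∷ [])) ∷ (split 9 ((found 0 0) ∷ [])) ∷ [])) ∷ [])) ∷ [])) ∷ (split 7 ((found 0
  239500800) ∷ (split 8 ((found 0 267541708) ∷ (split 8 ((found 0 267541708) ∷ (split 9 ((found 74 478994839) ∷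
  (split 10 ((found 74 478997624) ∷ [])) ∷ [])) ∷ [])) ∷ (split 8 ((found 3 267541708) ∷ (found 0 0) ∷ [])) ∷ []))
  ∷ [])) ∷ (split 7 ((found 6 239500800) ∷ (found 0 239500800) ∷ (split 8 ((found 6 267541708) ∷ (split 8 ((found
  6 267541708) ∷ (split 9 ((split 9 ((found 983 0) ∷ [])) ∷ [])) ∷ [])) ∷ [])) ∷ [])) ∷ [])) ∷ [])) ∷ [])) ∷
  (split 5 ((found 0 459055080) ∷ (found 46 478621873) ∷ (split 6 ((found 88 478990443) ∷ (split 6 ((found 88
  478990443) ∷ (split 7 ((split 7 (closed ∷ (split 9 ((split 10 ((split 11 []) ∷ [])) ∷ (split 10 ((split 10 []) ∷
  [])) ∷ [])) ∷ [])) ∷ (found 0 259471080) ∷ (split 7 ((found 0 239500800) ∷ (found 0 259471080) ∷ (split 8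
  ((found 7 465061228) ∷ (split 9 ((found 0 292088428) ∷ (split 10 ((found 95 478994995) ∷ [])) ∷ [])) ∷ [])) ∷
  [])) ∷ [])) ∷ (split 7 ((split 7 ((found 0 240166080) ∷ (split 9 ((split 9 ((split 11 []) ∷ [])) ∷ (split 9
  ((found 0 0) ∷ [])) ∷ [])) ∷ (split 9 ((split 9 ((split 10 ((found 104 478997625) ∷ [])) ∷ [])) ∷ (found 0
  240166080) ∷ [])) ∷ [])) ∷ (split 7 ((found 0 0) ∷ (split 8 ((found 20 465061228) ∷ (found 108 478994826) ∷
  (split 9 ((found 108 478994851) ∷ (split 10 ((found 1070 0) ∷ [])) ∷ [])) ∷ [])) ∷ (split 8 ((found 23
  465061228) ∷ (found 111 478994826) ∷ (split 9 ((split 10 ((found 1074 0) ∷ [])) ∷ (found 112 478994863) ∷ [])) ∷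
  [])) ∷ [])) ∷ (split 7 ((found 7 0) ∷ (found 0 0) ∷ (split 8 ((found 27 465061228) ∷ (found 115 478994826) ∷
  (split 9 ((split 9 ((found 0 336068188) ∷ [])) ∷ (found 1 336068188) ∷ [])) ∷ [])) ∷ [])) ∷ (split 7 ((found 11
  0) ∷ (found 4 0) ∷ (found 0 0) ∷ [])) ∷ [])) ∷ [])) ∷ (found 0 259471080) ∷ (split 6 ((found 122 478990443) ∷
  (found 0 239500800) ∷ (found 0 259471080) ∷ (split 7 ((found 0 240166080) ∷ (found 0 260136360) ∷ (split 7
  ((found 0 240166080) ∷ (found 0 260136360) ∷ (split 8 ((split 8 ((found 34 473044588) ∷ [])) ∷ (split 8 ((found
  0 0) ∷ (found 81 478876194) ∷ [])) ∷ [])) ∷ [])) ∷ [])) ∷ [])) ∷ [])) ∷ [])) ∷ [])) ∷ [])) ∷ [])) ∷ (split 3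
  ((found 0 478339225) ∷ (split 3 ((found 0 478336452) ∷ (split 4 ((found 133 478990153) ∷ (found 133 478990286) ∷
  (split 5 ((found 133 478990299) ∷ (split 6 (closed ∷ (split 7 ((split 8 ((split 9 ((split 9 ((split 10 ((found
  134 479001585) ∷ [])) ∷ [])) ∷ [])) ∷ [])) ∷ (split 8 ((split 8 ((split 9 ((found 138 478998812) ∷ (split 10
  ((split 10 []) ∷ [])) ∷ [])) ∷ [])) ∷ (split 8 ((found 0 239500800) ∷ (split 9 ((split 9 ((split 10 ((found 142
  478998944) ∷ [])) ∷ [])) ∷ [])) ∷ [])) ∷ [])) ∷ [])) ∷ [])) ∷ (split 6 ((found 0 459138252) ∷ (found 0
  463141824) ∷ (split 7 ((split 7 ((split 8 ((found 149 478996015) ∷ (split 9 ((split 10 ((split 11 []) ∷ [])) ∷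
  (split 10 ((split 10 []) ∷ [])) ∷ [])) ∷ [])) ∷ (split 8 ((found 0 243504492) ∷ (found 155 478996147) ∷ (split 9
  ((split 9 ((split 10 ((found 155 478998957) ∷ [])) ∷ [])) ∷ (found 0 243504492) ∷ [])) ∷ [])) ∷ [])) ∷ (found 0
  259554252) ∷ (split 7 ((found 0 239500800) ∷ (found 0 259554252) ∷ (split 8 ((found 0 263557824) ∷ (split 8
  ((found 0 263557824) ∷ (split 9 ((split 9 ((found 27 478996303) ∷ [])) ∷ [])) ∷ [])) ∷ [])) ∷ [])) ∷ [])) ∷ []))
  ∷ [])) ∷ [])) ∷ (split 4 ((found 169 478990153) ∷ (found 169 478990286) ∷ (split 5 ((split 6 (closed ∷ (split 7
  ((split 8 ((split 9 ((split 9 ((split 10 ((found 170 479001585) ∷ [])) ∷ [])) ∷ [])) ∷ [])) ∷ (split 8 ((split 8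
  ((split 9 ((found 174 478998812) ∷ (split 10 ((split 10 []) ∷ [])) ∷ [])) ∷ [])) ∷ (split 8 ((found 0 239500800)
  ∷ (split 9 ((split 9 ((split 10 ((found 178 478998944) ∷ [])) ∷ [])) ∷ [])) ∷ [])) ∷ [])) ∷ [])) ∷ [])) ∷ (found
  16 475678105) ∷ (split 6 ((split 6 ((split 8 ((split 9 ((split 9 ((split 10 ((found 185 479001597) ∷ [])) ∷ []))
  ∷ [])) ∷ [])) ∷ (split 8 ((split 8 ((split 9 ((found 189 478997492) ∷ (split 10 ((split 10 []) ∷ [])) ∷ [])) ∷
  [])) ∷ (split 8 ((found 0 239500800) ∷ (split 9 ((split 9 ((split 10 ((found 193 478997624) ∷ [])) ∷ [])) ∷ []))
  ∷ [])) ∷ [])) ∷ [])) ∷ (split 6 ((found 0 399168000) ∷ (split 7 ((found 0 404505157) ∷ (split 8 ((found 199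
  478993386) ∷ (split 9 ((split 10 ((split 11 []) ∷ [])) ∷ (split 10 ((split 10 []) ∷ [])) ∷ [])) ∷ [])) ∷ (split
  8 ((found 205 478993386) ∷ (found 0 324671557) ∷ (split 9 ((split 9 ((split 10 ((found 205 478998957) ∷ [])) ∷
  [])) ∷ (split 9 ((found 0 0) ∷ [])) ∷ [])) ∷ [])) ∷ [])) ∷ [])) ∷ (split 6 ((found 13 399168000) ∷ (found 0
  399168000) ∷ (split 7 ((found 13 404505157) ∷ (split 8 ((split 8 ((split 10 ((split 11 []) ∷ [])) ∷ (split 10
  ((split 10 []) ∷ [])) ∷ [])) ∷ (split 8 ((found 0 0) ∷ (split 9 ((found 217 478993518) ∷ (split 10 ((found 217
  478997624) ∷ [])) ∷ [])) ∷ [])) ∷ (split 8 ((found 3 0) ∷ (found 0 0) ∷ [])) ∷ [])) ∷ (split 8 ((split 8 ((split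
  9 ((found 222 478993518) ∷ (split 10 ((found 89 478981638) ∷ [])) ∷ [])) ∷ (found 2 165004357) ∷ [])) ∷ (split 8
  ((found 0 0) ∷ [])) ∷ [])) ∷ [])) ∷ [])) ∷ [])) ∷ [])) ∷ (split 5 ((found 0 459720492) ∷ (found 231 478990431) ∷
  (found 62 476343385) ∷ (split 6 ((split 6 ((split 7 ((found 231 478993230) ∷ (split 8 (closed ∷ (split 9 ((split
  10 ((split 11 []) ∷ [])) ∷ (split 10 ((split 10 []) ∷ [])) ∷ [])) ∷ [])) ∷ (split 8 ((split 9 ((split 10 ((split
  11 []) ∷ [])) ∷ (split 10 ((split 10 []) ∷ [])) ∷ [])) ∷ (found 5 323615198) ∷ (split 9 ((split 9 ((split 10
  ((found 243 478997637) ∷ [])) ∷ [])) ∷ (split 9 ((found 0 0) ∷ [])) ∷ [])) ∷ [])) ∷ [])) ∷ (split 7 ((split 8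
  (closed ∷ (split 9 ((split 10 ((split 11 []) ∷ [])) ∷ (split 10 ((split 10 []) ∷ [])) ∷ [])) ∷ [])) ∷ (found 7
  260136492) ∷ (split 8 ((split 8 ((split 10 ((split 11 []) ∷ [])) ∷ (split 10 ((split 10 []) ∷ [])) ∷ [])) ∷
  (split 8 ((found 0 0) ∷ (split 9 ((split 11 []) ∷ (split 10 ((found 262 478996304) ∷ [])) ∷ [])) ∷ [])) ∷ (split
  8 ((found 4 0) ∷ (found 0 0) ∷ [])) ∷ [])) ∷ [])) ∷ (split 7 ((found 0 260136492) ∷ (found 19 260136492) ∷
  (found 268 478993494) ∷ (split 8 ((split 8 ((split 9 ((found 268 478996172) ∷ (split 10 ((found 1172 0) ∷ [])) ∷
  [])) ∷ (split 9 ((split 10 ((found 1234 0) ∷ [])) ∷ (found 1 260136492) ∷ [])) ∷ [])) ∷ (split 8 ((found 0 0) ∷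
  (split 9 ((split 9 ((found 1238 0) ∷ [])) ∷ (split 9 ((found 0 0) ∷ [])) ∷ [])) ∷ [])) ∷ (split 8 ((found 4 0) ∷
  (found 0 0) ∷ [])) ∷ [])) ∷ [])) ∷ [])) ∷ (split 6 ((found 0 239500800) ∷ (split 7 ((split 7 (closed ∷ (split 9
  ((split 10 ((split 11 []) ∷ [])) ∷ (split 10 ((split 10 []) ∷ [])) ∷ [])) ∷ [])) ∷ (split 7 ((found 0 239500800)
  ∷ (split 8 ((split 10 ((split 11 []) ∷ [])) ∷ (split 10 ((split 10 []) ∷ [])) ∷ [])) ∷ [])) ∷ (split 7 ((found 6
  239500800) ∷ (found 0 239500800) ∷ (split 8 ((found 13 248817625) ∷ (split 9 ((found 0 281461526) ∷ (split 10
  ((found 294 478994995) ∷ [])) ∷ [])) ∷ [])) ∷ [])) ∷ [])) ∷ (split 7 ((found 0 248817625) ∷ (split 7 ((found 0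
  260136492) ∷ (split 8 ((found 18 248817625) ∷ (found 299 478993506) ∷ (split 9 ((found 299 478994839) ∷ (split
  10 ((found 1204 0) ∷ [])) ∷ [])) ∷ [])) ∷ (split 8 ((found 21 248817625) ∷ (found 302 478993506) ∷ (split 9
  ((split 10 ((found 1208 0) ∷ [])) ∷ (found 1 248817625) ∷ [])) ∷ [])) ∷ [])) ∷ (split 7 ((found 0 84687400) ∷
  (found 0 0) ∷ (split 8 ((found 25 248817625) ∷ (found 306 478993506) ∷ (split 9 ((split 9 ((found 1213 0) ∷ []))
  ∷ (split 9 ((found 0 0) ∷ [])) ∷ [])) ∷ [])) ∷ [])) ∷ (split 7 ((found 12 248817625) ∷ (found 5 0) ∷ (found 0 0)
  ∷ [])) ∷ [])) ∷ [])) ∷ (split 6 ((found 33 239500800) ∷ (found 0 239500800) ∷ (split 7 ((split 7 ((found 0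
  260136492) ∷ (split 8 ((found 33 248817625) ∷ (found 314 478994719) ∷ (split 9 ((found 314 478993518) ∷ (split
  10 ((found 1280 0) ∷ [])) ∷ [])) ∷ [])) ∷ (split 8 ((found 36 248817625) ∷ (split 9 ((found 0 9316825) ∷ (split
  10 ((found 36 450379906) ∷ [])) ∷ [])) ∷ (found 319 478994731) ∷ [])) ∷ [])) ∷ (found 7 260136492) ∷ (split 7
  ((found 0 0) ∷ (found 7 260136492) ∷ (split 8 ((found 40 248817625) ∷ (split 8 ((found 40 248817625) ∷ (split 9
  ((found 1288 0) ∷ [])) ∷ [])) ∷ (split 8 ((found 42 248817625) ∷ (found 0 0) ∷ [])) ∷ [])) ∷ [])) ∷ (split 7
  ((found 5 0) ∷ (found 12 260136492) ∷ (found 0 0) ∷ [])) ∷ [])) ∷ [])) ∷ (split 6 ((found 48 239500800) ∷ (found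
  15 239500800) ∷ (found 0 239500800) ∷ (split 7 ((found 0 260136492) ∷ (found 15 260136492) ∷ (split 7 ((found 0
  260136492) ∷ (found 15 260136492) ∷ (split 8 ((found 48 248817625) ∷ (split 8 ((found 48 248817625) ∷ (found 196
  478874874) ∷ [])) ∷ [])) ∷ [])) ∷ [])) ∷ [])) ∷ [])) ∷ [])) ∷ [])) ∷ [])) ∷ (found 0 475104972) ∷ (split 3
  ((found 205 478339225) ∷ (found 0 475009920) ∷ (found 0 475104972) ∷ (split 4 ((found 338 478990153) ∷ (found
  338 478990286) ∷ (split 5 ((split 5 ((found 0 475202677) ∷ (split 6 ((found 0 475203998) ∷ (found 338 478991897)
  ∷ (split 7 ((found 338 478990587) ∷ (split 8 ((found 0 475455260) ∷ (split 9 ((split 10 ((split 11 []) ∷ [])) ∷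
  (split 10 ((split 10 []) ∷ [])) ∷ [])) ∷ [])) ∷ (split 8 ((split 9 ((split 10 ((split 11 []) ∷ [])) ∷ (split 10
  ((split 10 []) ∷ [])) ∷ [])) ∷ (found 0 80501785) ∷ (split 9 ((split 9 ((split 10 ((found 349 478998957) ∷ []))
  ∷ [])) ∷ (split 9 ((found 0 0) ∷ [])) ∷ [])) ∷ [])) ∷ [])) ∷ [])) ∷ (split 6 ((found 18 475203998) ∷ (found 0
  399263052) ∷ (found 356 478992029) ∷ (split 7 ((found 356 478990587) ∷ (found 0 419319157) ∷ (found 0 439278878)
  ∷ (split 8 ((split 8 ((split 9 ((found 356 478994840) ∷ (split 10 ((found 1264 0) ∷ [])) ∷ [])) ∷ (split 9
  ((split 10 ((found 20 475661204) ∷ [])) ∷ (found 1 260127385) ∷ [])) ∷ [])) ∷ (found 0 79928652) ∷ (split 8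
  ((found 0 0) ∷ (found 0 79928652) ∷ [])) ∷ [])) ∷ [])) ∷ [])) ∷ [])) ∷ (found 28 475202677) ∷ (split 5 ((found 0
  399168000) ∷ (found 28 475202677) ∷ (split 6 ((found 28 475203998) ∷ (split 6 ((found 28 475203998) ∷ (split 7
  (closed ∷ (split 9 ((split 10 ((split 11 []) ∷ [])) ∷ (split 10 ((split 10 []) ∷ [])) ∷ [])) ∷ [])) ∷ (split 7
  ((split 9 ((split 10 ((split 11 []) ∷ [])) ∷ (split 10 ((split 10 []) ∷ [])) ∷ [])) ∷ (found 0 79928652) ∷
  (split 9 ((split 9 ((split 10 ((found 378 478997625) ∷ [])) ∷ [])) ∷ (split 9 ((found 0 0) ∷ [])) ∷ [])) ∷ []))
  ∷ [])) ∷ (split 6 ((found 46 475203998) ∷ (found 0 239500800) ∷ (split 7 ((found 384 478990587) ∷ (found 0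
  260224948) ∷ (split 8 ((found 384 478992053) ∷ (split 9 ((split 11 []) ∷ [])) ∷ (split 9 ((found 386 478993518)
  ∷ (split 10 ((found 48 477001401) ∷ [])) ∷ [])) ∷ [])) ∷ (split 8 ((found 389 478992053) ∷ (split 9 ((found 389
  478993518) ∷ (split 10 ((found 1357 0) ∷ [])) ∷ [])) ∷ (split 9 ((found 391 478993518) ∷ (found 53 475550324) ∷
  [])) ∷ [])) ∷ [])) ∷ [])) ∷ (split 6 ((found 57 475203998) ∷ (found 11 239500800) ∷ (found 0 239500800) ∷ (split
  7 ((found 395 478990587) ∷ (split 8 ((found 395 478992053) ∷ (split 9 ((split 11 []) ∷ (split 10 ((found 396
  478993674) ∷ [])) ∷ [])) ∷ [])) ∷ (split 8 ((found 399 478992053) ∷ (split 9 ((split 9 []) ∷ [])) ∷ (split 9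
  ((split 9 ((found 63 478973877) ∷ [])) ∷ (split 9 ((found 0 0) ∷ [])) ∷ [])) ∷ [])) ∷ [])) ∷ [])) ∷ [])) ∷ []))
  ∷ (split 5 ((found 43 399168000) ∷ (found 71 475202677) ∷ (found 0 399168000) ∷ (split 6 ((found 71 475203998) ∷
  (found 0 399263052) ∷ (split 6 ((found 71 475203998) ∷ (found 0 399263052) ∷ (split 7 ((found 409 478990587) ∷
  (found 0 419892148) ∷ (split 8 ((split 8 ((found 276 478790237) ∷ (split 10 ((found 1378 0) ∷ [])) ∷ [])) ∷
  (split 8 ((found 0 0) ∷ [])) ∷ [])) ∷ [])) ∷ (split 7 ((found 414 478990587) ∷ (found 5 419892148) ∷ (found 5
  439850548) ∷ (found 5 459904000) ∷ [])) ∷ [])) ∷ (split 6 ((found 78 475203998) ∷ (found 7 399263052) ∷ (found 0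
  0) ∷ [])) ∷ [])) ∷ [])) ∷ [])) ∷ (split 5 ((split 5 ((found 0 401166745) ∷ (found 82 475392757) ∷ (found 0
  441083545) ∷ [])) ∷ (split 5 ((found 0 243492480) ∷ (split 6 ((split 6 ((found 288 478657947) ∷ (found 83
  475394078) ∷ (split 8 ((found 0 331362811) ∷ (found 1 402150747) ∷ (found 0 411196411) ∷ [])) ∷ [])) ∷ (found 85
  475394078) ∷ (split 6 ((found 0 239500800) ∷ (found 85 475394078) ∷ (split 7 ((found 423 478990587) ∷ (found 0
  265449625) ∷ (split 8 ((found 0 269441305) ∷ (found 290 478848027) ∷ (found 3 403006107) ∷ [])) ∷ [])) ∷ [])) ∷
  [])) ∷ (found 89 475392757) ∷ (split 6 ((split 6 ((found 0 243587532) ∷ (found 89 475394078) ∷ (split 8 ((split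
  8 ((found 6 249720053) ∷ (split 9 ((split 11 []) ∷ (found 428 478994972) ∷ [])) ∷ [])) ∷ (found 9 249720053) ∷
  (split 8 ((found 0 0) ∷ (found 9 249720053) ∷ [])) ∷ [])) ∷ (split 8 ((split 8 ((split 9 ((found 432 478994852)
  ∷ (split 10 ((found 1402 65866946) ∷ [])) ∷ [])) ∷ (found 0 239595852) ∷ [])) ∷ (split 8 ((found 0 0) ∷ (split 9
  ((split 9 ((found 1406 72618628) ∷ [])) ∷ (found 0 239595852) ∷ [])) ∷ [])) ∷ (found 0 239595852) ∷ [])) ∷ []))
  ∷ (split 6 ((found 0 0) ∷ (found 102 475394078) ∷ (split 7 ((found 440 478990587) ∷ (found 0 45907225) ∷ (found
  440 478992173) ∷ (split 8 ((found 0 49900226) ∷ (found 440 478993506) ∷ (split 9 ((split 9 ((found 0 72618628) ∷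
  [])) ∷ (split 9 ((found 0 0) ∷ [])) ∷ [])) ∷ [])) ∷ [])) ∷ (split 7 ((found 445 478990587) ∷ (found 5 45907225)
  ∷ (found 445 478992173) ∷ (split 8 ((found 5 69858626) ∷ (split 9 ((split 9 ((found 1417 0) ∷ [])) ∷ (found 0
  243587532) ∷ [])) ∷ (found 447 478993638) ∷ [])) ∷ [])) ∷ [])) ∷ (found 112 475394078) ∷ (split 6 ((found 10 0)
  ∷ (found 0 0) ∷ (found 112 475394078) ∷ (split 7 ((found 450 478990587) ∷ (found 10 45907225) ∷ (found 450
  478992173) ∷ (split 8 ((split 8 ((split 9 ((found 1423 0) ∷ [])) ∷ (found 1 221604151) ∷ [])) ∷ (split 8 ((found
  0 0) ∷ (found 31 327021627) ∷ [])) ∷ (split 8 ((found 1 0) ∷ (found 0 0) ∷ [])) ∷ [])) ∷ [])) ∷ [])) ∷ (split 6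
  ((found 17 0) ∷ (found 7 0) ∷ (found 119 475394078) ∷ (found 0 0) ∷ [])) ∷ [])) ∷ [])) ∷ (found 122 475392757) ∷
  (split 5 ((found 39 243492480) ∷ (found 0 239500800) ∷ (found 122 475392757) ∷ (split 6 ((found 0 239595852) ∷
  (found 122 475394078) ∷ (split 6 ((found 0 239595852) ∷ (found 122 475394078) ∷ (split 7 ((found 460 478990587)
  ∷ (split 7 ((found 460 478990587) ∷ (split 8 ((split 8 ((found 1434 243492480) ∷ [])) ∷ (split 8 ((found 0
  243492480) ∷ [])) ∷ [])) ∷ [])) ∷ (split 7 ((found 464 478990587) ∷ (found 0 239500800) ∷ (found 331 478778513)
  ∷ [])) ∷ [])) ∷ [])) ∷ [])) ∷ [])) ∷ [])) ∷ [])) ∷ [])) ∷ [])) ∷ [])) ∷ (split 2 ((found 474 478989864) ∷ (found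
  0 478336320) ∷ (split 3 ((found 0 478336452) ∷ (found 0 478550304) ∷ (split 3 ((found 0 478336452) ∷ (found 0
  478550304) ∷ (split 4 ((found 474 478990153) ∷ (split 4 ((found 474 478990153) ∷ (split 5 ((found 0 478550593) ∷
  (split 5 ((found 0 478550593) ∷ (split 6 ((found 474 478990442) ∷ (found 0 478645922) ∷ (found 0 478836002) ∷
  [])) ∷ (split 6 ((found 475 478990442) ∷ (found 1 478645922) ∷ (found 1 478740962) ∷ (found 1 478836002) ∷
  (found 1 478931042) ∷ [])) ∷ [])) ∷ (split 5 ((found 3 478550593) ∷ (found 0 239500800) ∷ (split 6 ((found 477
  478990442) ∷ (found 3 478645922) ∷ (found 3 478836002) ∷ [])) ∷ [])) ∷ [])) ∷ (split 5 ((found 0 239714652) ∷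
  (split 5 ((found 0 239512680) ∷ (found 0 239928504) ∷ (split 6 ((found 480 478990442) ∷ (found 480 478991896) ∷
  (split 7 (closed ∷ (split 8 ((split 10 ((split 11 []) ∷ [])) ∷ (split 10 ((split 10 []) ∷ [])) ∷ [])) ∷ [])) ∷
  (split 7 ((found 0 260136360) ∷ (found 487 478992041) ∷ (found 13 478598402) ∷ (split 8 ((found 487 478990731) ∷
  (found 13 478504816) ∷ (split 9 ((split 10 ((found 1462 0) ∷ [])) ∷ (found 14 478610571) ∷ [])) ∷ [])) ∷ [])) ∷
  [])) ∷ (split 6 ((found 492 478990442) ∷ (found 492 478991896) ∷ (split 7 ((found 0 259673052) ∷ (found 12
  249254436) ∷ (found 492 478992173) ∷ (split 8 ((found 18 478492936) ∷ (split 9 ((found 12 252297736) ∷ (split 10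
  ((found 18 478516973) ∷ [])) ∷ [])) ∷ (split 9 ((split 10 ((found 20 478516973) ∷ [])) ∷ (found 1 259673052) ∷
  [])) ∷ [])) ∷ [])) ∷ (found 0 83828185) ∷ (split 7 ((split 9 ((split 9 ((split 10 ((found 498 478994997) ∷ []))
  ∷ [])) ∷ (found 0 240391812) ∷ [])) ∷ (split 8 ((found 501 478990731) ∷ (split 9 ((found 27 478598691) ∷ (split
  10 ((found 1477 0) ∷ [])) ∷ [])) ∷ (found 29 478516696) ∷ [])) ∷ (found 504 478992173) ∷ (found 30 478610282) ∷
  [])) ∷ [])) ∷ [])) ∷ (found 27 239928504) ∷ (found 0 248814852) ∷ (split 5 ((found 27 239714652) ∷ (found 0
  239500800) ∷ (found 27 239928504) ∷ (found 0 248814852) ∷ (split 6 ((found 507 478990442) ∷ (found 507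
  478991896) ∷ (split 7 ((found 0 249693984) ∷ (found 27 249254436) ∷ (split 7 ((found 0 249693984) ∷ (found 27
  249254436) ∷ (split 8 ((found 33 478492936) ∷ (found 0 439990357) ∷ [])) ∷ [])) ∷ [])) ∷ (found 3 439396357) ∷
  [])) ∷ [])) ∷ [])) ∷ (split 5 ((found 33 239714652) ∷ (split 5 ((found 33 239512680) ∷ (found 0 240177960) ∷
  (found 39 478598113) ∷ (found 0 411145945) ∷ [])) ∷ (split 5 ((found 1 239512680) ∷ (found 0 0) ∷ (found 34
  248826732) ∷ (found 40 478598113) ∷ (split 6 ((found 514 478990442) ∷ (found 1 239714652) ∷ (found 1 259673052)
  ∷ (found 514 478992160) ∷ (found 1 379711237) ∷ [])) ∷ [])) ∷ (found 42 478598113) ∷ (split 5 ((found 36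
  239714652) ∷ (found 2 0) ∷ (found 0 0) ∷ (found 42 478598113) ∷ [])) ∷ [])) ∷ [])) ∷ (found 0 248814852) ∷
  (split 4 ((found 519 478990153) ∷ (found 0 239500800) ∷ (found 0 248814852) ∷ (split 5 ((found 0 239512680) ∷
  (found 0 248826732) ∷ (found 45 478978273) ∷ [])) ∷ [])) ∷ [])) ∷ [])) ∷ [])) ∷ [])) ∷ [])) ∷ [])) ∷ [])) ∷ []))
  ∷ [])) ∷ [])

-- The search has a name so that no later conversion check runs it again.
search : Maybe (Settled (edgeless 12) × Library)
search = verify listedPatterns (edgeless 12) certificate

search-succeeds : is-just search ≡ true
search-succeeds = refl

settled : ∀ P (result : Maybe (Settled P × Library)) → is-just result ≡ true → Settled P
settled P (just (s , _)) _ = s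

edgeless-settled : Settled (edgeless 12)
edgeless-settled = settled (edgeless 12) search search-succeeds

theorem8p3 : Classification 17 68
theorem8p3 = record
  { bal            = balancedGraphs
  ; unbal          = unbalancedGraphs
  ; bal-cc         = λ i → balanced-connected i , balanced-cubic i
  ; unbal-cc       = λ i → unbalanced-connected i , unbalanced-cubic i
  ; bal-3b         = balanced-balanced
  ; unbal-¬3b      = unbalanced-unbalanced
  ; bal-distinct   = left-distinct balancedGraphs unbalancedGraphs invariants-unique
  ; unbal-distinct = right-distinct balancedGraphs unbalancedGraphs invariants-unique
  ; cross-distinct = cross-distinct balancedGraphs unbalancedGraphs invariants-unique
  -- The edgeless pattern embeds in every graph, so its being settled is completeness itself.
  ; complete       = λ G cc → edgeless-settled G cc (edgeless↪ G)
  }
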